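{- Let $m$ be a complex number and let $x$ be an indeterminate. The sequence of Tanny-Dowling polynomials $\mathcal{F}_m(n,x)=\sum_{k=0}^n k!\,W_m(n,k)x^k$, $n\ge 0$, is the moment sequence of a family of orthogonal polynomials over the field $\mathbb{C}(x)$.
   Context: The Whitney numbers of the second kind of Dowling lattices are $W_m(n,k)=\sum_{i=k}^n\binom{n}{i}m^{i-k}S(i,k)$ (with $0^0=1$), where $S(i,k)$ are the Stirling numbers of the second kind; for $m\ne 0$ this is equivalent to $\sum_{n\ge 0} W_m(n,k)\frac{z^n}{n!}=\frac{e^z}{m^k k!}(e^{mz}-1)^k$, and $W_0(n,k)=\binom{n}{k}$. Orthogonality is meant in the formal (algebraic) sense. Let $K=\mathbb{C}(x)$. A family of orthogonal polynomials over $K$ is a sequence $(P_n(z))_{n\ge 0}$ of monic polynomials in $K[z]$ with $\deg P_n=n$ for which there is a $K$-linear functional $\mathcal{L}:K[z]\to K$ with $\mathcal{L}(1)=1$, $\mathcal{L}(P_iP_j)=0$ for all $i\ne j$, and $\mathcal{L}(P_n^2)\neq 0$ for all $n$. Its moment sequence is $(\mathcal{L}(z^n))_{n\ge 0}$. -}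

module Defs where

open import Level using (_⊔_; 0ℓ)
open import Algebra.Bundles using (CommutativeRing; CommutativeMonoid; Semiring)
open import Algebra.Module.Bundles using (LeftModule)
open import Algebra.Module.Morphism.Structures using (module LeftModuleMorphisms)
import Algebra.Module.Construct.TensorUnit as TensorUnit
import Algebra.Definitions.RawSemiring as RawSemiringOps
import Algebra.Properties.CommutativeSemigroup as CommutativeSemigroupProperties
import Algebra.Properties.Ring as RingProperties
import Algebra.Solver.Ring.NaturalCoefficients.Default as SemiringSolver
open import Data.Empty using (⊥; ⊥-elim)
open import Data.Fin.Base using (toℕ)
open import Data.List.Base using (List; []; _∷_; map)
open import Data.Nat.Base as ℕ using (ℕ; zero; suc; _!)
open import Data.Nat.Combinatorics using (_C_)
import Data.Nat.Properties as ℕ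
open import Data.Product.Base using (∃-syntax; _×_; _,_)
open import Data.Rational.Base as ℚ using (ℚ; 0ℚ; 1ℚ; ½; ∣_∣)
import Data.Rational.Properties as ℚ
open import Data.Rational.Solver using (module +-*-Solver)
open import Data.Sum.Base using (_⊎_; inj₁; inj₂)
open import Relation.Nullary using (¬_; yes; no)
import Relation.Binary.Reasoning.Setoid as SetoidReasoning
open import Relation.Binary.PropositionalEquality as ≡ using (_≡_; _≢_)

module RationalSequences where

  open import Data.Rational.Base using (_+_; _*_; _-_; -_; _<_; _≤_)

  Null : (ℕ → ℚ) → Set
  Null f = ∀ ε → 0ℚ < ε → ∃[ N ] (∀ n → N ℕ.≤ n → ∣ f n ∣ < ε)

  Cauchy : (ℕ → ℚ) → Set
  Cauchy f = ∀ ε → 0ℚ < ε →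
    ∃[ N ] (∀ m n → N ℕ.≤ m → N ℕ.≤ n → ∣ f m - f n ∣ < ε)

  Apart : (ℕ → ℚ) → Set
  Apart f = ∃[ δ ] (0ℚ < δ × ∃[ N ] (∀ n → N ℕ.≤ n → δ < ∣ f n ∣))

  half-pos : ∀ ε → 0ℚ < ε → 0ℚ < ε * ½
  half-pos ε 0<ε = ℚ.*-monoˡ-<-pos ½ 0<ε

  half+half : ∀ ε → ε * ½ + ε * ½ ≡ ε
  half+half ε = ≡.trans (≡.sym (ℚ.*-distribˡ-+ ε ½ ½)) (ℚ.*-identityʳ ε)

  triangle : ∀ {a b d e} → ∣ a ∣ < d → ∣ b ∣ < e → ∣ a + b ∣ < d + e
  triangle {a} {b} p q = ℚ.≤-<-trans (ℚ.∣p+q∣≤∣p∣+∣q∣ a b) (ℚ.+-mono-< p q)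

  half-triangle : ∀ {a b} ε → ∣ a ∣ < ε * ½ → ∣ b ∣ < ε * ½ → ∣ a + b ∣ < ε
  half-triangle {a} {b} ε p q =
    ≡.subst (∣ a + b ∣ <_) (half+half ε) (triangle {a} {b} p q)

  -- Lemmas whose results are matched on using `with` are abstract: otherwise
  -- their rational arithmetic is normalised, at great cost.
  abstract
    divide : ∀ B ε → 0ℚ < B → 0ℚ < ε → ∃[ δ ] (0ℚ < δ × B * δ ≡ ε)
    divide B ε 0<B 0<ε = (ℚ.1/ B) * ε , positive , cancels
      where
      instance
        B>0 : ℚ.Positive B
        B>0 = ℚ.positive 0<B
        ε>0 : ℚ.Positive ε
        ε>0 = ℚ.positive 0<ε
        B≢0 : ℚ.NonZero B
        B≢0 = ℚ.pos⇒nonZero B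
        B⁻¹>0 : ℚ.Positive (ℚ.1/ B)
        B⁻¹>0 = ℚ.1/pos⇒pos B
      positive : 0ℚ < (ℚ.1/ B) * ε
      positive = ℚ.positive⁻¹ _ {{ℚ.pos*pos⇒pos (ℚ.1/ B) ε}}
      cancels : B * ((ℚ.1/ B) * ε) ≡ ε
      cancels = ≡.trans (≡.sym (ℚ.*-assoc B (ℚ.1/ B) ε))
        (≡.trans (≡.cong (_* ε) (ℚ.*-inverseʳ B)) (ℚ.*-identityˡ ε))

  *-mono-∣∣ : ∀ {a b d e} → ∣ a ∣ < d → ∣ b ∣ < e → ∣ a * b ∣ < d * e
  *-mono-∣∣ {a} {b} {d} {e} p q = begin-strict
    ∣ a * b ∣      ≡⟨ ℚ.∣p*q∣≡∣p∣*∣q∣ a b ⟩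
    ∣ a ∣ * ∣ b ∣  ≤⟨ ℚ.*-monoʳ-≤-nonNeg ∣ b ∣ {{ℚ.∣-∣-nonNeg b}} (ℚ.<⇒≤ p) ⟩
    d * ∣ b ∣      <⟨ ℚ.*-monoʳ-<-pos d {{ℚ.positive (ℚ.≤-<-trans (ℚ.0≤∣p∣ a) p)}} q ⟩
    d * e          ∎
    where open ℚ.≤-Reasoning

  Null-≗ : ∀ {f g} → (∀ n → f n ≡ g n) → Null f → Null g
  Null-≗ f≗g f→0 ε 0<ε with N , p ← f→0 ε 0<ε =
    N , λ n N≤n → ≡.subst (λ q → ∣ q ∣ < ε) (f≗g n) (p n N≤n)

  Null-zero : Null (λ _ → 0ℚ)
  Null-zero ε 0<ε = 0 , λ _ _ → 0<ε

  Null-neg : ∀ {f} → Null f → Null (λ n → - f n)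
  Null-neg {f} f→0 ε 0<ε with N , p ← f→0 ε 0<ε =
    N , λ n N≤n → ≡.subst (_< ε) (≡.sym (ℚ.∣-p∣≡∣p∣ (f n))) (p n N≤n)

  Null-+ : ∀ {f g} → Null f → Null g → Null (λ n → f n + g n)
  Null-+ {f} {g} f→0 g→0 ε 0<ε
    with M , p ← f→0 (ε * ½) (half-pos ε 0<ε)
       | N , q ← g→0 (ε * ½) (half-pos ε 0<ε) =
    M ℕ.⊔ N , λ n M⊔N≤n → half-triangle {f n} {g n} ε
      (p n (ℕ.m⊔n≤o⇒m≤o M N M⊔N≤n)) (q n (ℕ.m⊔n≤o⇒n≤o M N M⊔N≤n))

  abstract
    Cauchy⇒bounded : ∀ {f} → Cauchy f →
      ∃[ B ] (0ℚ < B × ∃[ N ] (∀ n → N ℕ.≤ n → ∣ f n ∣ < B))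
    Cauchy⇒bounded {f} cf with N , p ← cf 1ℚ (ℚ.positive⁻¹ 1ℚ) =
      1ℚ + ∣ f N ∣ , 0<B , N , bound
      where
      open ℚ.≤-Reasoning
      0<B : 0ℚ < 1ℚ + ∣ f N ∣
      0<B = ℚ.+-mono-<-≤ (ℚ.positive⁻¹ 1ℚ) (ℚ.0≤∣p∣ (f N))
      telescope : ∀ a b → (a - b) + b ≡ a
      telescope = solve 2 (λ a b → (a :- b) :+ b := a) ≡.refl
        where open +-*-Solver
      bound : ∀ n → N ℕ.≤ n → ∣ f n ∣ < 1ℚ + ∣ f N ∣
      bound n N≤n = begin-strict
        ∣ f n ∣                    ≡⟨ ≡.cong ∣_∣ (telescope (f n) (f N)) ⟨
        ∣ (f n - f N) + f N ∣      ≤⟨ ℚ.∣p+q∣≤∣p∣+∣q∣ (f n - f N) (f N) ⟩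
        ∣ f n - f N ∣ + ∣ f N ∣    <⟨ ℚ.+-monoˡ-< ∣ f N ∣ (p n N N≤n ℕ.≤-refl) ⟩
        1ℚ + ∣ f N ∣               ∎

  Null-* : ∀ {f g} → Cauchy f → Null g → Null (λ n → f n * g n)
  Null-* {f} {g} cf g→0 ε 0<ε
    with B , 0<B , M , p ← Cauchy⇒bounded cf
    with δ , 0<δ , Bδ≡ε ← divide B ε 0<B 0<ε
    with N , q ← g→0 δ 0<δ =
    M ℕ.⊔ N , λ n M⊔N≤n → ≡.subst (∣ f n * g n ∣ <_) Bδ≡ε
      (*-mono-∣∣ {f n} {g n} (p n (ℕ.m⊔n≤o⇒m≤o M N M⊔N≤n)) (q n (ℕ.m⊔n≤o⇒n≤o M N M⊔N≤n)))

  Cauchy-const : ∀ q → Cauchy (λ _ → q)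
  Cauchy-const q ε 0<ε = 0 , λ _ _ _ _ →
    ≡.subst (λ r → ∣ r ∣ < ε) (≡.sym (ℚ.+-inverseʳ q)) 0<ε

  Cauchy-neg : ∀ {f} → Cauchy f → Cauchy (λ n → - f n)
  Cauchy-neg {f} cf ε 0<ε with N , p ← cf ε 0<ε =
    N , λ m n N≤m N≤n → ≡.subst (_< ε)
      (≡.trans (≡.sym (ℚ.∣-p∣≡∣p∣ (f m - f n))) (≡.cong ∣_∣ (eq (f m) (f n)))) (p m n N≤m N≤n)
    where
    eq : ∀ a b → - (a - b) ≡ (- a) - (- b)
    eq = solve 2 (λ a b → :- (a :- b) := (:- a) :- (:- b)) ≡.refl
      where open +-*-Solver

  Cauchy-+ : ∀ {f g} → Cauchy f → Cauchy g → Cauchy (λ n → f n + g n)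
  Cauchy-+ {f} {g} cf cg ε 0<ε
    with M , p ← cf (ε * ½) (half-pos ε 0<ε)
       | N , q ← cg (ε * ½) (half-pos ε 0<ε) =
    M ℕ.⊔ N , λ m n i j → ≡.subst (λ r → ∣ r ∣ < ε) (eq (f m) (f n) (g m) (g n))
      (half-triangle {f m - f n} {g m - g n} ε
        (p m n (ℕ.m⊔n≤o⇒m≤o M N i) (ℕ.m⊔n≤o⇒m≤o M N j))
        (q m n (ℕ.m⊔n≤o⇒n≤o M N i) (ℕ.m⊔n≤o⇒n≤o M N j)))
    where
    eq : ∀ a b c d → (a - b) + (c - d) ≡ (a + c) - (b + d)
    eq = solve 4 (λ a b c d → (a :- b) :+ (c :- d) := (a :+ c) :- (b :+ d)) ≡.refl
      where open +-*-Solver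

  Cauchy-* : ∀ {f g} → Cauchy f → Cauchy g → Cauchy (λ n → f n * g n)
  Cauchy-* {f} {g} cf cg ε 0<ε
    with B , 0<B , M₁ , p₁ ← Cauchy⇒bounded cf
       | D , 0<D , M₂ , p₂ ← Cauchy⇒bounded cg
    with δ₁ , 0<δ₁ , Bδ₁≡ ← divide B (ε * ½) 0<B (half-pos ε 0<ε)
       | δ₂ , 0<δ₂ , Dδ₂≡ ← divide D (ε * ½) 0<D (half-pos ε 0<ε)
    with N₁ , q₁ ← cg δ₁ 0<δ₁
       | N₂ , q₂ ← cf δ₂ 0<δ₂ =
    N , λ m n i j → ≡.subst (λ r → ∣ r ∣ < ε) (eq (f m) (f n) (g m) (g n))
      (half-triangle {f m * (g m - g n)} {g n * (f m - f n)} ε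
        (≡.subst (∣ f m * (g m - g n) ∣ <_) Bδ₁≡
          (*-mono-∣∣ {f m} {g m - g n} (p₁ m (M₁≤ i)) (q₁ m n (N₁≤ i) (N₁≤ j))))
        (≡.subst (∣ g n * (f m - f n) ∣ <_) Dδ₂≡
          (*-mono-∣∣ {g n} {f m - f n} (p₂ n (M₂≤ j)) (q₂ m n (N₂≤ i) (N₂≤ j)))))
    where
    M = M₁ ℕ.⊔ M₂
    N′ = N₁ ℕ.⊔ N₂
    N = M ℕ.⊔ N′
    M₁≤ : ∀ {k} → N ℕ.≤ k → M₁ ℕ.≤ k
    M₁≤ i = ℕ.m⊔n≤o⇒m≤o M₁ M₂ (ℕ.m⊔n≤o⇒m≤o M N′ i)
    M₂≤ : ∀ {k} → N ℕ.≤ k → M₂ ℕ.≤ k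
    M₂≤ i = ℕ.m⊔n≤o⇒n≤o M₁ M₂ (ℕ.m⊔n≤o⇒m≤o M N′ i)
    N₁≤ : ∀ {k} → N ℕ.≤ k → N₁ ℕ.≤ k
    N₁≤ i = ℕ.m⊔n≤o⇒m≤o N₁ N₂ (ℕ.m⊔n≤o⇒n≤o M N′ i)
    N₂≤ : ∀ {k} → N ℕ.≤ k → N₂ ℕ.≤ k
    N₂≤ i = ℕ.m⊔n≤o⇒n≤o N₁ N₂ (ℕ.m⊔n≤o⇒n≤o M N′ i)
    eq : ∀ a b c d → a * (c - d) + d * (a - b) ≡ a * c - b * d
    eq = solve 4 (λ a b c d → a :* (c :- d) :+ d :* (a :- b) := a :* c :- b :* d) ≡.refl
      where open +-*-Solver

  Null∧Apart⇒⊥ : ∀ {f} → Null f → Apart f → ⊥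
  Null∧Apart⇒⊥ f→0 (δ , 0<δ , M , p) with N , q ← f→0 δ 0<δ =
    ℚ.<-asym (p (M ℕ.⊔ N) (ℕ.m≤m⊔n M N)) (q (M ℕ.⊔ N) (ℕ.m≤n⊔m M N))

  abstract
    small⊎Apart : ∀ {f} → Cauchy f → ∀ ε → 0ℚ < ε →
      ∃[ N ] (∀ n → N ℕ.≤ n → ∣ f n ∣ < ε) ⊎ Apart f
    small⊎Apart {f} cf ε 0<ε
      with N , p ← cf (ε * ½ * ½) (half-pos (ε * ½) (half-pos ε 0<ε))
      with ∣ f N ∣ ℚ.<? ε * ½
    ... | yes ∣fN∣<δ = inj₁ (N , λ n N≤n → begin-strict
            ∣ f n ∣                  ≡⟨ ≡.cong ∣_∣ (eq (f n) (f N)) ⟨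
            ∣ f N + (f n - f N) ∣    <⟨ triangle {f N} {f n - f N} ∣fN∣<δ (p n N N≤n ℕ.≤-refl) ⟩
            ε * ½ + ε * ½ * ½        <⟨ ℚ.+-monoʳ-< (ε * ½) quarter<half ⟩
            ε * ½ + ε * ½            ≡⟨ half+half ε ⟩
            ε                        ∎)
      where
      open ℚ.≤-Reasoning
      eq : ∀ a b → b + (a - b) ≡ a
      eq = solve 2 (λ a b → b :+ (a :- b) := a) ≡.refl
        where open +-*-Solver
      0<δ : 0ℚ < ε * ½
      0<δ = half-pos ε 0<ε
      quarter<half : ε * ½ * ½ < ε * ½
      quarter<half = begin-strict
        ε * ½ * ½               ≡⟨ ℚ.+-identityʳ _ ⟨
        ε * ½ * ½ + 0ℚ          <⟨ ℚ.+-monoʳ-< (ε * ½ * ½) (half-pos (ε * ½) 0<δ) ⟩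
        ε * ½ * ½ + ε * ½ * ½   ≡⟨ half+half (ε * ½) ⟩
        ε * ½                   ∎
    ... | no ∣fN∣≮δ = inj₂ (γ , half-pos (ε * ½) (half-pos ε 0<ε) , N , λ n N≤n →
            ℚ.≰⇒> (λ ∣fn∣≤γ → ∣fN∣≮δ (begin-strict
              ∣ f N ∣                  ≡⟨ ≡.cong ∣_∣ (eq (f N) (f n)) ⟨
              ∣ (f N - f n) + f n ∣    ≤⟨ ℚ.∣p+q∣≤∣p∣+∣q∣ (f N - f n) (f n) ⟩
              ∣ f N - f n ∣ + ∣ f n ∣  <⟨ ℚ.+-mono-<-≤ (p N n ℕ.≤-refl N≤n) ∣fn∣≤γ ⟩
              γ + γ                    ≡⟨ half+half (ε * ½) ⟩
              ε * ½                    ∎)))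
      where
      open ℚ.≤-Reasoning
      γ : ℚ
      γ = ε * ½ * ½
      eq : ∀ a b → (a - b) + b ≡ a
      eq = solve 2 (λ a b → (a :- b) :+ b := a) ≡.refl
        where open +-*-Solver

  ¬Apart⇒Null : ∀ {f} → Cauchy f → ¬ Apart f → Null f
  ¬Apart⇒Null cf ¬f# ε 0<ε with small⊎Apart cf ε 0<ε
  ... | inj₁ p  = p
  ... | inj₂ f# = ⊥-elim (¬f# f#)

  Null-stable : ∀ {f} → Cauchy f → ¬ ¬ Null f → Null f
  Null-stable cf ¬¬null = ¬Apart⇒Null cf λ f# → ¬¬null λ null → Null∧Apart⇒⊥ null f#

  Apart-* : ∀ {f g} → Apart f → Apart g → Apart (λ n → f n * g n)
  Apart-* {f} {g} (δ , 0<δ , M , p) (ε , 0<ε , N , q) =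
    δ * ε , 0<δε , M ℕ.⊔ N , λ n i → begin-strict
      δ * ε              <⟨ ℚ.*-monoʳ-<-pos δ {{ℚ.positive 0<δ}} (q n (ℕ.m⊔n≤o⇒n≤o M N i)) ⟩
      δ * ∣ g n ∣        ≤⟨ ℚ.*-monoʳ-≤-nonNeg ∣ g n ∣ {{ℚ.∣-∣-nonNeg (g n)}} (ℚ.<⇒≤ (p n (ℕ.m⊔n≤o⇒m≤o M N i))) ⟩
      ∣ f n ∣ * ∣ g n ∣  ≡⟨ ℚ.∣p*q∣≡∣p∣*∣q∣ (f n) (g n) ⟨
      ∣ f n * g n ∣      ∎
    where
    open ℚ.≤-Reasoning
    0<δε : 0ℚ < δ * ε
    0<δε = ℚ.positive⁻¹ _ {{ℚ.pos*pos⇒pos δ {{ℚ.positive 0<δ}} ε {{ℚ.positive 0<ε}}}}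

  Null-*⇒Null : ∀ {f g} → Cauchy f → Cauchy g →
    Null (λ n → f n * g n) → ¬ Null f → Null g
  Null-*⇒Null {f} {g} cf cg fg→0 ¬f→0 = ¬Apart⇒Null cg λ g# →
    ¬f→0 (¬Apart⇒Null cf λ f# → Null∧Apart⇒⊥ fg→0 (Apart-* {f} {g} f# g#))

  0≤square : ∀ q → 0ℚ ≤ q * q
  0≤square q = ≡.subst (0ℚ ≤_) ∣q∣²≡q² 0≤∣q∣²
    where
    0≤∣q∣² : 0ℚ ≤ ∣ q ∣ * ∣ q ∣
    0≤∣q∣² = ≡.subst (_≤ ∣ q ∣ * ∣ q ∣) (ℚ.*-zeroˡ ∣ q ∣)
      (ℚ.*-monoʳ-≤-nonNeg ∣ q ∣ {{ℚ.∣-∣-nonNeg q}} (ℚ.0≤∣p∣ q))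
    neg² : ∀ a → (- a) * (- a) ≡ a * a
    neg² = solve 1 (λ a → (:- a) :* (:- a) := a :* a) ≡.refl
      where open +-*-Solver
    ∣q∣²≡q² : ∣ q ∣ * ∣ q ∣ ≡ q * q
    ∣q∣²≡q² with ℚ.∣p∣≡p∨∣p∣≡-p q
    ... | inj₁ eq = ≡.cong₂ _*_ eq eq
    ... | inj₂ eq = ≡.trans (≡.cong₂ _*_ eq eq) (neg² q)

  Null-sumOfSquares : ∀ {f g : ℕ → ℚ} → Cauchy f → Null (λ n → f n * f n + g n * g n) → Null f
  Null-sumOfSquares {f} {g} cf null =
    ¬Apart⇒Null cf λ f# → Null∧Apart⇒⊥ {λ n → f n * f n + g n * g n} null (enlarge (Apart-* {f} {f} f# f#))
    where
    open ℚ.≤-Reasoning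
    0≤sum : ∀ n → 0ℚ ≤ f n * f n + g n * g n
    0≤sum n = ℚ.+-mono-≤ (0≤square (f n)) (0≤square (g n))
    enlarge : Apart (λ n → f n * f n) → Apart (λ n → f n * f n + g n * g n)
    enlarge (δ , 0<δ , N , p) = δ , 0<δ , N , λ n N≤n → begin-strict
      δ                              <⟨ p n N≤n ⟩
      ∣ f n * f n ∣                  ≡⟨ ℚ.0≤p⇒∣p∣≡p (0≤square (f n)) ⟩
      f n * f n                      ≡⟨ ℚ.+-identityʳ (f n * f n) ⟨
      f n * f n + 0ℚ                 ≤⟨ ℚ.+-monoʳ-≤ (f n * f n) (0≤square (g n)) ⟩
      f n * f n + g n * g n          ≡⟨ ℚ.0≤p⇒∣p∣≡p (0≤sum n) ⟨
      ∣ f n * f n + g n * g n ∣      ∎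

module Reals where

  open RationalSequences

  -- The modulus of convergence is part of the data (the Cauchy condition is a
  -- Σ-type).  Having no η, and operations defined by copatterns, keeps the ring
  -- operations from unfolding during unification.
  record ℝ : Set where
    no-eta-equality
    field
      seq    : ℕ → ℚ
      cauchy : Cauchy seq

  open ℝ public

  infix 4 _≈_
  record _≈_ (x y : ℝ) : Set where
    constructor null
    field
      difference : Null (λ n → seq x n ℚ.- seq y n)

  open _≈_ public

  infixl 6 _+_
  infixl 7 _*_
  infix  8 -_

  _+_ _*_ : ℝ → ℝ → ℝ
  seq    (x + y) n = seq x n ℚ.+ seq y n
  cauchy (x + y)   = Cauchy-+ {seq x} {seq y} (cauchy x) (cauchy y)
  seq    (x * y) n = seq x n ℚ.* seq y n
  cauchy (x * y)   = Cauchy-* {seq x} {seq y} (cauchy x) (cauchy y)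

  -_ : ℝ → ℝ
  seq    (- x) n = ℚ.- seq x n
  cauchy (- x)   = Cauchy-neg {seq x} (cauchy x)

  fromℚ : ℚ → ℝ
  seq    (fromℚ q) _ = q
  cauchy (fromℚ q)   = Cauchy-const q

  0ℝ 1ℝ : ℝ
  0ℝ = fromℚ 0ℚ
  1ℝ = fromℚ 1ℚ

  pointwise : ∀ {x y} → (∀ n → seq x n ≡ seq y n) → x ≈ y
  pointwise {x} {y} x≗y = null (Null-≗ (λ n → ≡.trans (≡.sym (ℚ.+-inverseʳ (seq y n)))
    (≡.cong (ℚ._- seq y n) (≡.sym (x≗y n)))) Null-zero)

  ≈-refl : ∀ {x} → x ≈ x
  ≈-refl = pointwise λ _ → ≡.refl

  ≈-sym : ∀ {x y} → x ≈ y → y ≈ x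
  ≈-sym {x} {y} (null p) = null (Null-≗ (λ n → eq (seq x n) (seq y n)) (Null-neg p))
    where
    open +-*-Solver
    eq : ∀ a b → ℚ.- (a ℚ.- b) ≡ b ℚ.- a
    eq = solve 2 (λ a b → :- (a :- b) := b :- a) ≡.refl

  ≈-trans : ∀ {x y z} → x ≈ y → y ≈ z → x ≈ z
  ≈-trans {x} {y} {z} (null p) (null q) =
    null (Null-≗ (λ n → eq (seq x n) (seq y n) (seq z n)) (Null-+ p q))
    where
    open +-*-Solver
    eq : ∀ a b c → (a ℚ.- b) ℚ.+ (b ℚ.- c) ≡ a ℚ.- c
    eq = solve 3 (λ a b c → (a :- b) :+ (b :- c) := a :- c) ≡.refl

  +-cong : ∀ {x y u v} → x ≈ y → u ≈ v → x + u ≈ y + v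
  +-cong {x} {y} {u} {v} (null p) (null q) =
    null (Null-≗ (λ n → eq (seq x n) (seq y n) (seq u n) (seq v n)) (Null-+ p q))
    where
    open +-*-Solver
    eq : ∀ a b c d → (a ℚ.- b) ℚ.+ (c ℚ.- d) ≡ (a ℚ.+ c) ℚ.- (b ℚ.+ d)
    eq = solve 4 (λ a b c d → (a :- b) :+ (c :- d) := (a :+ c) :- (b :+ d)) ≡.refl

  *-cong : ∀ {x y u v} → x ≈ y → u ≈ v → x * u ≈ y * v
  *-cong {x} {y} {u} {v} (null p) (null q) =
    null (Null-≗ (λ n → eq (seq x n) (seq y n) (seq u n) (seq v n))
      (Null-+ {λ n → seq x n ℚ.* (seq u n ℚ.- seq v n)} {λ n → seq v n ℚ.* (seq x n ℚ.- seq y n)}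
        (Null-* {seq x} {λ n → seq u n ℚ.- seq v n} (cauchy x) q)
        (Null-* {seq v} {λ n → seq x n ℚ.- seq y n} (cauchy v) p)))
    where
    open +-*-Solver
    eq : ∀ a b c d → a ℚ.* (c ℚ.- d) ℚ.+ d ℚ.* (a ℚ.- b) ≡ a ℚ.* c ℚ.- b ℚ.* d
    eq = solve 4 (λ a b c d → a :* (c :- d) :+ d :* (a :- b) := a :* c :- b :* d) ≡.refl

  -‿cong : ∀ {x y} → x ≈ y → - x ≈ - y
  -‿cong {x} {y} (null p) = null (Null-≗ (λ n → eq (seq x n) (seq y n)) (Null-neg p))
    where
    open +-*-Solver
    eq : ∀ a b → ℚ.- (a ℚ.- b) ≡ (ℚ.- a) ℚ.- (ℚ.- b)
    eq = solve 2 (λ a b → :- (a :- b) := (:- a) :- (:- b)) ≡.refl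

  ≈-stable : ∀ x y → ¬ ¬ (x ≈ y) → x ≈ y
  ≈-stable x y ¬¬x≈y = null (Null-stable (Cauchy-+ {seq x} {seq (- y)} (cauchy x) (cauchy (- y)))
    λ ¬null → ¬¬x≈y λ x≈y → ¬null (difference x≈y))

  ≈0⇒Null : ∀ {x} → x ≈ 0ℝ → Null (seq x)
  ≈0⇒Null {x} (null p) = Null-≗ (λ n → ℚ.+-identityʳ (seq x n)) p

  Null⇒≈0 : ∀ {x} → Null (seq x) → x ≈ 0ℝ
  Null⇒≈0 {x} p = null (Null-≗ (λ n → ≡.sym (ℚ.+-identityʳ (seq x n))) p)

  1≉0 : ¬ (1ℝ ≈ 0ℝ)
  1≉0 1≈0 with N , p ← ≈0⇒Null 1≈0 1ℚ (ℚ.positive⁻¹ 1ℚ) = ℚ.<-irrefl ≡.refl (p N ℕ.≤-refl)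

  x*y≈0∧x≉0⇒y≈0 : ∀ {x y} → x * y ≈ 0ℝ → ¬ (x ≈ 0ℝ) → y ≈ 0ℝ
  x*y≈0∧x≉0⇒y≈0 {x} {y} xy≈0 x≉0 = Null⇒≈0 (Null-*⇒Null {seq x} {seq y} (cauchy x) (cauchy y)
    (≈0⇒Null {x * y} xy≈0) (λ x→0 → x≉0 (Null⇒≈0 x→0)))

  x²+y²≈0⇒x≈0 : ∀ {x y} → x * x + y * y ≈ 0ℝ → x ≈ 0ℝ
  x²+y²≈0⇒x≈0 {x} {y} p = Null⇒≈0 (Null-sumOfSquares {seq x} {seq y} (cauchy x) (≈0⇒Null {x * x + y * y} p))


  ring : CommutativeRing 0ℓ 0ℓ
  ring = record
    { Carrier = ℝ ; _≈_ = _≈_ ; _+_ = _+_ ; _*_ = _*_ ; -_ = -_ ; 0# = 0ℝ ; 1# = 1ℝ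
    ; isCommutativeRing = record
      { isRing = record
        { +-isAbelianGroup = record
          { isGroup = record
            { isMonoid = record
              { isSemigroup = record
                { isMagma = record
                  { isEquivalence = record { refl = ≈-refl ; sym = ≈-sym ; trans = ≈-trans }
                  ; ∙-cong = +-cong
                  }
                ; assoc = λ x y z → pointwise λ n → ℚ.+-assoc (seq x n) (seq y n) (seq z n)
                }
              ; identity = (λ x → pointwise λ n → ℚ.+-identityˡ (seq x n))
                         , (λ x → pointwise λ n → ℚ.+-identityʳ (seq x n))
              }
            ; inverse = (λ x → pointwise λ n → ℚ.+-inverseˡ (seq x n))
                      , (λ x → pointwise λ n → ℚ.+-inverseʳ (seq x n))
            ; ⁻¹-cong = -‿cong
            }
          ; comm = λ x y → pointwise λ n → ℚ.+-comm (seq x n) (seq y n)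
          }
        ; *-cong = *-cong
        ; *-assoc = λ x y z → pointwise λ n → ℚ.*-assoc (seq x n) (seq y n) (seq z n)
        ; *-identity = (λ x → pointwise λ n → ℚ.*-identityˡ (seq x n))
                     , (λ x → pointwise λ n → ℚ.*-identityʳ (seq x n))
        ; distrib = (λ x y z → pointwise λ n → ℚ.*-distribˡ-+ (seq x n) (seq y n) (seq z n))
                  , (λ x y z → pointwise λ n → ℚ.*-distribʳ-+ (seq x n) (seq y n) (seq z n))
        }
      ; *-comm = λ x y → pointwise λ n → ℚ.*-comm (seq x n) (seq y n)
      }
    }

-- Equality on ℝ and ℂ is undecidable but ¬¬-stable.  With x ≉ 0 read as
-- ¬ (x ≈ 0), stability is what carries the absence of zero divisors over to
-- polynomials, so that fractions with any nonzero denominator can be formed.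
record IsStableDomain {c ℓ} (R : CommutativeRing c ℓ) : Set (c ⊔ ℓ) where
  open CommutativeRing R
  field
    1≉0             : 1# ≉ 0#
    ≈-stable        : ∀ x y → ¬ ¬ (x ≈ y) → x ≈ y
    x*y≈0∧x≉0⇒y≈0   : ∀ {x y} → x * y ≈ 0# → x ≉ 0# → y ≈ 0#

module ComplexNumbers where

  open Reals using (ℝ; seq; pointwise; 0ℝ; 1ℝ)
  open CommutativeRing Reals.ring using ()
    renaming (_≈_ to _≈ʳ_; _+_ to _+ʳ_; _*_ to _*ʳ_; -_ to -ʳ_)
  private
    module ℝᵣ = CommutativeRing Reals.ring

  record ℂ : Set where
    no-eta-equality
    field
      re im : ℝ

  open ℂ public

  infix 4 _≈_
  record _≈_ (z w : ℂ) : Set where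
    constructor _,_
    field
      re-≈ : re z ≈ʳ re w
      im-≈ : im z ≈ʳ im w

  infixl 6 _+_
  infixl 7 _*_
  infix  8 -_

  _+_ _*_ : ℂ → ℂ → ℂ
  re (z + w) = re z +ʳ re w
  im (z + w) = im z +ʳ im w
  re (z * w) = re z *ʳ re w +ʳ (-ʳ (im z *ʳ im w))
  im (z * w) = re z *ʳ im w +ʳ im z *ʳ re w

  -_ : ℂ → ℂ
  re (- z) = -ʳ re z
  im (- z) = -ʳ im z

  0ℂ 1ℂ : ℂ
  re 0ℂ = 0ℝ
  im 0ℂ = 0ℝ
  re 1ℂ = 1ℝ
  im 1ℂ = 0ℝ

  *-assoc-re : ∀ a b c d e f →
    (a ℚ.* c ℚ.- b ℚ.* d) ℚ.* e ℚ.- (a ℚ.* d ℚ.+ b ℚ.* c) ℚ.* f ≡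
    a ℚ.* (c ℚ.* e ℚ.- d ℚ.* f) ℚ.- b ℚ.* (c ℚ.* f ℚ.+ d ℚ.* e)
  *-assoc-re = solve 6 (λ a b c d e f →
    (a :* c :- b :* d) :* e :- (a :* d :+ b :* c) :* f :=
    a :* (c :* e :- d :* f) :- b :* (c :* f :+ d :* e)) ≡.refl
    where open +-*-Solver

  *-assoc-im : ∀ a b c d e f →
    (a ℚ.* c ℚ.- b ℚ.* d) ℚ.* f ℚ.+ (a ℚ.* d ℚ.+ b ℚ.* c) ℚ.* e ≡
    a ℚ.* (c ℚ.* f ℚ.+ d ℚ.* e) ℚ.+ b ℚ.* (c ℚ.* e ℚ.- d ℚ.* f)
  *-assoc-im = solve 6 (λ a b c d e f →
    (a :* c :- b :* d) :* f :+ (a :* d :+ b :* c) :* e :=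
    a :* (c :* f :+ d :* e) :+ b :* (c :* e :- d :* f)) ≡.refl
    where open +-*-Solver

  *-comm-re : ∀ a b c d →
    a ℚ.* c ℚ.- b ℚ.* d ≡
    c ℚ.* a ℚ.- d ℚ.* b
  *-comm-re = solve 4 (λ a b c d →
    a :* c :- b :* d :=
    c :* a :- d :* b) ≡.refl
    where open +-*-Solver

  *-comm-im : ∀ a b c d →
    a ℚ.* d ℚ.+ b ℚ.* c ≡
    c ℚ.* b ℚ.+ d ℚ.* a
  *-comm-im = solve 4 (λ a b c d →
    a :* d :+ b :* c :=
    c :* b :+ d :* a) ≡.refl
    where open +-*-Solver

  *-identityˡ-re : ∀ a b →
    1ℚ ℚ.* a ℚ.- 0ℚ ℚ.* b ≡
    a
  *-identityˡ-re = solve 2 (λ a b →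
    con 1ℚ :* a :- con 0ℚ :* b :=
    a) ≡.refl
    where open +-*-Solver

  *-identityˡ-im : ∀ a b →
    1ℚ ℚ.* b ℚ.+ 0ℚ ℚ.* a ≡
    b
  *-identityˡ-im = solve 2 (λ a b →
    con 1ℚ :* b :+ con 0ℚ :* a :=
    b) ≡.refl
    where open +-*-Solver

  *-distribˡ-+-re : ∀ a b c d e f →
    a ℚ.* (c ℚ.+ e) ℚ.- b ℚ.* (d ℚ.+ f) ≡
    (a ℚ.* c ℚ.- b ℚ.* d) ℚ.+ (a ℚ.* e ℚ.- b ℚ.* f)
  *-distribˡ-+-re = solve 6 (λ a b c d e f →
    a :* (c :+ e) :- b :* (d :+ f) :=
    (a :* c :- b :* d) :+ (a :* e :- b :* f)) ≡.refl
    where open +-*-Solver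

  *-distribˡ-+-im : ∀ a b c d e f →
    a ℚ.* (d ℚ.+ f) ℚ.+ b ℚ.* (c ℚ.+ e) ≡
    (a ℚ.* d ℚ.+ b ℚ.* c) ℚ.+ (a ℚ.* f ℚ.+ b ℚ.* e)
  *-distribˡ-+-im = solve 6 (λ a b c d e f →
    a :* (d :+ f) :+ b :* (c :+ e) :=
    (a :* d :+ b :* c) :+ (a :* f :+ b :* e)) ≡.refl
    where open +-*-Solver

  norm²-*-eq : ∀ a b c d →
    (a ℚ.* a ℚ.+ b ℚ.* b) ℚ.* (c ℚ.* c ℚ.+ d ℚ.* d) ≡
    (a ℚ.* c ℚ.- b ℚ.* d) ℚ.* (a ℚ.* c ℚ.- b ℚ.* d) ℚ.+ (a ℚ.* d ℚ.+ b ℚ.* c) ℚ.* (a ℚ.* d ℚ.+ b ℚ.* c)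
  norm²-*-eq = solve 4 (λ a b c d →
    (a :* a :+ b :* b) :* (c :* c :+ d :* d) :=
    (a :* c :- b :* d) :* (a :* c :- b :* d) :+ (a :* d :+ b :* c) :* (a :* d :+ b :* c)) ≡.refl
    where open +-*-Solver

  *-assoc : ∀ z w v → (z * w) * v ≈ z * (w * v)
  *-assoc z w v
    = pointwise (λ n → *-assoc-re (seq (re z) n) (seq (im z) n) (seq (re w) n) (seq (im w) n) (seq (re v) n) (seq (im v) n))
    , pointwise (λ n → *-assoc-im (seq (re z) n) (seq (im z) n) (seq (re w) n) (seq (im w) n) (seq (re v) n) (seq (im v) n))

  *-comm : ∀ z w → z * w ≈ w * z
  *-comm z w
    = pointwise (λ n → *-comm-re (seq (re z) n) (seq (im z) n) (seq (re w) n) (seq (im w) n))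
    , pointwise (λ n → *-comm-im (seq (re z) n) (seq (im z) n) (seq (re w) n) (seq (im w) n))

  *-identityˡ : ∀ z → 1ℂ * z ≈ z
  *-identityˡ z
    = pointwise (λ n → *-identityˡ-re (seq (re z) n) (seq (im z) n))
    , pointwise (λ n → *-identityˡ-im (seq (re z) n) (seq (im z) n))

  *-distribˡ-+ : ∀ z w v → z * (w + v) ≈ z * w + z * v
  *-distribˡ-+ z w v
    = pointwise (λ n → *-distribˡ-+-re (seq (re z) n) (seq (im z) n) (seq (re w) n) (seq (im w) n) (seq (re v) n) (seq (im v) n))
    , pointwise (λ n → *-distribˡ-+-im (seq (re z) n) (seq (im z) n) (seq (re w) n) (seq (im w) n) (seq (re v) n) (seq (im v) n))

  ≈-sym : ∀ {z w} → z ≈ w → w ≈ z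
  ≈-sym (p , q) = ℝᵣ.sym p , ℝᵣ.sym q

  ≈-trans : ∀ {z w v} → z ≈ w → w ≈ v → z ≈ v
  ≈-trans (p , q) (p′ , q′) = ℝᵣ.trans p p′ , ℝᵣ.trans q q′

  *-cong : ∀ {z w v u} → z ≈ w → v ≈ u → z * v ≈ w * u
  *-cong (p , q) (p′ , q′)
    = ℝᵣ.+-cong (ℝᵣ.*-cong p p′) (ℝᵣ.-‿cong (ℝᵣ.*-cong q q′))
    , ℝᵣ.+-cong (ℝᵣ.*-cong p q′) (ℝᵣ.*-cong q p′)

  *-identityʳ : ∀ z → z * 1ℂ ≈ z
  *-identityʳ z = ≈-trans (*-comm z 1ℂ) (*-identityˡ z)

  +-cong : ∀ {z w v u} → z ≈ w → v ≈ u → z + v ≈ w + u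
  +-cong (p , q) (p′ , q′) = ℝᵣ.+-cong p p′ , ℝᵣ.+-cong q q′

  *-distribʳ-+ : ∀ z w v → (w + v) * z ≈ w * z + v * z
  *-distribʳ-+ z w v = ≈-trans (*-comm (w + v) z)
    (≈-trans (*-distribˡ-+ z w v) (+-cong (*-comm z w) (*-comm z v)))

  ring : CommutativeRing 0ℓ 0ℓ
  ring = record
    { Carrier = ℂ ; _≈_ = _≈_ ; _+_ = _+_ ; _*_ = _*_ ; -_ = -_ ; 0# = 0ℂ ; 1# = 1ℂ
    ; isCommutativeRing = record
      { isRing = record
        { +-isAbelianGroup = record
          { isGroup = record
            { isMonoid = record
              { isSemigroup = record
                { isMagma = record
                  { isEquivalence = record
                    { refl = ℝᵣ.refl , ℝᵣ.refl ; sym = ≈-sym ; trans = ≈-trans }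
                  ; ∙-cong = +-cong
                  }
                ; assoc = λ z w v → ℝᵣ.+-assoc (re z) (re w) (re v) , ℝᵣ.+-assoc (im z) (im w) (im v)
                }
              ; identity = (λ z → ℝᵣ.+-identityˡ (re z) , ℝᵣ.+-identityˡ (im z))
                         , (λ z → ℝᵣ.+-identityʳ (re z) , ℝᵣ.+-identityʳ (im z))
              }
            ; inverse = (λ z → ℝᵣ.-‿inverseˡ (re z) , ℝᵣ.-‿inverseˡ (im z))
                      , (λ z → ℝᵣ.-‿inverseʳ (re z) , ℝᵣ.-‿inverseʳ (im z))
            ; ⁻¹-cong = λ (p , q) → ℝᵣ.-‿cong p , ℝᵣ.-‿cong q
            }
          ; comm = λ z w → ℝᵣ.+-comm (re z) (re w) , ℝᵣ.+-comm (im z) (im w)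
          }
        ; *-cong = *-cong
        ; *-assoc = *-assoc
        ; *-identity = *-identityˡ , *-identityʳ
        ; distrib = *-distribˡ-+ , *-distribʳ-+
        }
      ; *-comm = *-comm
      }
    }

  norm² : ℂ → ℝ
  norm² z = re z *ʳ re z +ʳ im z *ʳ im z

  norm²-* : ∀ z w → norm² z *ʳ norm² w ≈ʳ norm² (z * w)
  norm²-* z w =
    pointwise (λ n → norm²-*-eq (seq (re z) n) (seq (im z) n) (seq (re w) n) (seq (im w) n))

  norm²≈0⇒≈0 : ∀ {z} → norm² z ≈ʳ 0ℝ → z ≈ 0ℂ
  norm²≈0⇒≈0 {z} p
    = Reals.x²+y²≈0⇒x≈0 {re z} {im z} p
    , Reals.x²+y²≈0⇒x≈0 {im z} {re z} (ℝᵣ.trans (ℝᵣ.+-comm (im z *ʳ im z) (re z *ʳ re z)) p)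

  ≈0⇒norm²≈0 : ∀ {z} → z ≈ 0ℂ → norm² z ≈ʳ 0ℝ
  ≈0⇒norm²≈0 (p , q) = ℝᵣ.trans (ℝᵣ.+-cong (ℝᵣ.*-cong p p) (ℝᵣ.*-cong q q)) (pointwise λ _ → ≡.refl)

  isStableDomain : IsStableDomain ring
  isStableDomain = record
    { 1≉0 = λ (1≈0 , _) → Reals.1≉0 1≈0
    ; ≈-stable = λ z w ¬¬z≈w
        → Reals.≈-stable (re z) (re w) (λ ¬p → ¬¬z≈w λ (p , _) → ¬p p)
        , Reals.≈-stable (im z) (im w) (λ ¬q → ¬¬z≈w λ (_ , q) → ¬q q)
    ; x*y≈0∧x≉0⇒y≈0 = λ {z} {w} zw≈0 z≉0 → norm²≈0⇒≈0 {w}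
        (Reals.x*y≈0∧x≉0⇒y≈0 {norm² z} {norm² w}
          (ℝᵣ.trans (norm²-* z w) (≈0⇒norm²≈0 {z * w} zw≈0))
          (λ p → z≉0 (norm²≈0⇒≈0 {z} p)))
    }

module Polynomials {c ℓ} (R : CommutativeRing c ℓ) where

  private
    module R = CommutativeRing R
    open R using () renaming (Carrier to A)
    module RP = RingProperties R.ring

  -- Coefficients from degree 0 upwards; trailing zeros are allowed.
  Poly : Set c
  Poly = List A

  coeff : Poly → ℕ → A
  coeff []      _       = R.0#
  coeff (a ∷ p) zero    = a
  coeff (a ∷ p) (suc i) = coeff p i

  infix 4 _≈_
  record _≈_ (p q : Poly) : Set ℓ where
    constructor coeffs
    field
      coeff-≈ : ∀ i → coeff p i R.≈ coeff q i

  open _≈_ public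

  infixl 6 _+_
  infixl 7 _*_
  infixr 8 _·_
  infix  8 -_

  _+_ : Poly → Poly → Poly
  []      + q       = q
  (a ∷ p) + []      = a ∷ p
  (a ∷ p) + (b ∷ q) = (a R.+ b) ∷ (p + q)

  -_ : Poly → Poly
  - p = map R.-_ p

  _·_ : A → Poly → Poly
  a · p = map (a R.*_) p

  _*_ : Poly → Poly → Poly
  []      * q = []
  (a ∷ p) * q = a · q + (R.0# ∷ p * q)

  const : A → Poly
  const a = a ∷ []

  0ₚ 1ₚ X : Poly
  0ₚ = []
  1ₚ = const R.1#
  X  = R.0# ∷ R.1# ∷ []

  IsMonicOfDegree : ℕ → Poly → Set ℓ
  IsMonicOfDegree n p = coeff p n R.≈ R.1# × (∀ i → n ℕ.< i → coeff p i R.≈ R.0#)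

  coeff-+ : ∀ p q i → coeff (p + q) i R.≈ coeff p i R.+ coeff q i
  coeff-+ []      q       i       = R.sym (R.+-identityˡ (coeff q i))
  coeff-+ (a ∷ p) []      i       = R.sym (R.+-identityʳ (coeff (a ∷ p) i))
  coeff-+ (a ∷ p) (b ∷ q) zero    = R.refl
  coeff-+ (a ∷ p) (b ∷ q) (suc i) = coeff-+ p q i

  coeff-neg : ∀ p i → coeff (- p) i R.≈ R.- coeff p i
  coeff-neg []      i       = R.sym RP.-0#≈0#
  coeff-neg (a ∷ p) zero    = R.refl
  coeff-neg (a ∷ p) (suc i) = coeff-neg p i

  coeff-· : ∀ a p i → coeff (a · p) i R.≈ a R.* coeff p i
  coeff-· a []      i       = R.sym (R.zeroʳ a)
  coeff-· a (b ∷ p) zero    = R.refl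
  coeff-· a (b ∷ p) (suc i) = coeff-· a p i

  ≈-refl : ∀ {p} → p ≈ p
  ≈-refl = coeffs λ _ → R.refl

  ≈-sym : ∀ {p q} → p ≈ q → q ≈ p
  ≈-sym p≈q = coeffs λ i → R.sym (coeff-≈ p≈q i)

  ≈-trans : ∀ {p q r} → p ≈ q → q ≈ r → p ≈ r
  ≈-trans p≈q q≈r = coeffs λ i → R.trans (coeff-≈ p≈q i) (coeff-≈ q≈r i)

  ∷-cong : ∀ {a b p q} → a R.≈ b → p ≈ q → a ∷ p ≈ b ∷ q
  ∷-cong a≈b p≈q = coeffs λ where
    zero    → a≈b
    (suc i) → coeff-≈ p≈q i

  0∷0≈0 : ∀ {a p} → a R.≈ R.0# → p ≈ [] → a ∷ p ≈ []
  0∷0≈0 a≈0 p≈0 = coeffs λ where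
    zero    → a≈0
    (suc i) → coeff-≈ p≈0 i

  tail≈0 : ∀ {a p} → a ∷ p ≈ [] → p ≈ []
  tail≈0 a∷p≈0 = coeffs λ i → coeff-≈ a∷p≈0 (suc i)

  +-cong : ∀ {p q r s} → p ≈ q → r ≈ s → p + r ≈ q + s
  +-cong {p} {q} {r} {s} p≈q r≈s = coeffs λ i → R.trans (coeff-+ p r i)
    (R.trans (R.+-cong (coeff-≈ p≈q i) (coeff-≈ r≈s i)) (R.sym (coeff-+ q s i)))

  +-assoc : ∀ p q r → (p + q) + r ≈ p + (q + r)
  +-assoc p q r = coeffs λ i → begin
    coeff ((p + q) + r) i                      ≈⟨ coeff-+ (p + q) r i ⟩
    coeff (p + q) i R.+ coeff r i              ≈⟨ R.+-congʳ (coeff-+ p q i) ⟩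
    coeff p i R.+ coeff q i R.+ coeff r i      ≈⟨ R.+-assoc _ _ _ ⟩
    coeff p i R.+ (coeff q i R.+ coeff r i)    ≈⟨ R.+-congˡ (coeff-+ q r i) ⟨
    coeff p i R.+ coeff (q + r) i              ≈⟨ coeff-+ p (q + r) i ⟨
    coeff (p + (q + r)) i                      ∎
    where open SetoidReasoning R.setoid

  +-comm : ∀ p q → p + q ≈ q + p
  +-comm p q = coeffs λ i → R.trans (coeff-+ p q i)
    (R.trans (R.+-comm _ _) (R.sym (coeff-+ q p i)))

  +-identityˡ : ∀ p → [] + p ≈ p
  +-identityˡ p = ≈-refl

  +-identityʳ : ∀ p → p + [] ≈ p
  +-identityʳ p = +-comm p []

  -‿cong : ∀ {p q} → p ≈ q → - p ≈ - q
  -‿cong {p} {q} p≈q = coeffs λ i → R.trans (coeff-neg p i)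
    (R.trans (R.-‿cong (coeff-≈ p≈q i)) (R.sym (coeff-neg q i)))

  -‿inverseʳ : ∀ p → p + (- p) ≈ []
  -‿inverseʳ p = coeffs λ i → R.trans (coeff-+ p (- p) i)
    (R.trans (R.+-congˡ (coeff-neg p i)) (R.-‿inverseʳ (coeff p i)))

  -‿inverseˡ : ∀ p → (- p) + p ≈ []
  -‿inverseˡ p = ≈-trans (+-comm (- p) p) (-‿inverseʳ p)

  ·-cong : ∀ {a b p q} → a R.≈ b → p ≈ q → a · p ≈ b · q
  ·-cong {a} {b} {p} {q} a≈b p≈q = coeffs λ i → R.trans (coeff-· a p i)
    (R.trans (R.*-cong a≈b (coeff-≈ p≈q i)) (R.sym (coeff-· b q i)))

  ·-zeroˡ : ∀ p → R.0# · p ≈ []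
  ·-zeroˡ p = coeffs λ i → R.trans (coeff-· R.0# p i) (R.zeroˡ (coeff p i))

  ·-identityˡ : ∀ p → R.1# · p ≈ p
  ·-identityˡ p = coeffs λ i → R.trans (coeff-· R.1# p i) (R.*-identityˡ (coeff p i))

  ·-assoc : ∀ a b p → (a R.* b) · p ≈ a · (b · p)
  ·-assoc a b p = coeffs λ i → begin
    coeff ((a R.* b) · p) i      ≈⟨ coeff-· (a R.* b) p i ⟩
    (a R.* b) R.* coeff p i      ≈⟨ R.*-assoc a b (coeff p i) ⟩
    a R.* (b R.* coeff p i)      ≈⟨ R.*-congˡ (coeff-· b p i) ⟨
    a R.* coeff (b · p) i        ≈⟨ coeff-· a (b · p) i ⟨
    coeff (a · (b · p)) i        ∎
    where open SetoidReasoning R.setoid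

  ·-distribˡ-+ : ∀ a p q → a · (p + q) ≈ a · p + a · q
  ·-distribˡ-+ a p q = coeffs λ i → begin
    coeff (a · (p + q)) i                      ≈⟨ coeff-· a (p + q) i ⟩
    a R.* coeff (p + q) i                      ≈⟨ R.*-congˡ (coeff-+ p q i) ⟩
    a R.* (coeff p i R.+ coeff q i)            ≈⟨ R.distribˡ a _ _ ⟩
    a R.* coeff p i R.+ a R.* coeff q i        ≈⟨ R.+-cong (coeff-· a p i) (coeff-· a q i) ⟨
    coeff (a · p) i R.+ coeff (a · q) i        ≈⟨ coeff-+ (a · p) (a · q) i ⟨
    coeff (a · p + a · q) i                    ∎
    where open SetoidReasoning R.setoid

  ·-distribʳ-+ : ∀ p a b → (a R.+ b) · p ≈ a · p + b · p
  ·-distribʳ-+ p a b = coeffs λ i → begin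
    coeff ((a R.+ b) · p) i                    ≈⟨ coeff-· (a R.+ b) p i ⟩
    (a R.+ b) R.* coeff p i                    ≈⟨ R.distribʳ (coeff p i) a b ⟩
    a R.* coeff p i R.+ b R.* coeff p i        ≈⟨ R.+-cong (coeff-· a p i) (coeff-· b p i) ⟨
    coeff (a · p) i R.+ coeff (b · p) i        ≈⟨ coeff-+ (a · p) (b · p) i ⟨
    coeff (a · p + b · p) i                    ∎
    where open SetoidReasoning R.setoid

  leftModule : LeftModule R.ring c ℓ
  leftModule = record
    { Carrierᴹ = Poly ; _≈ᴹ_ = _≈_ ; _+ᴹ_ = _+_ ; _*ₗ_ = _·_ ; 0ᴹ = 0ₚ ; -ᴹ_ = -_
    ; isLeftModule = record
      { isLeftSemimodule = record
        { +ᴹ-isCommutativeMonoid = record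
          { isMonoid = record
            { isSemigroup = record
              { isMagma = record
                { isEquivalence = record { refl = ≈-refl ; sym = ≈-sym ; trans = ≈-trans }
                ; ∙-cong = +-cong
                }
              ; assoc = +-assoc
              }
            ; identity = +-identityˡ , +-identityʳ
            }
          ; comm = +-comm
          }
        ; isPreleftSemimodule = record
          { *ₗ-cong = ·-cong
          ; *ₗ-zeroˡ = ·-zeroˡ
          ; *ₗ-distribʳ = ·-distribʳ-+
          ; *ₗ-identityˡ = ·-identityˡ
          ; *ₗ-assoc = ·-assoc
          ; *ₗ-zeroʳ = λ _ → ≈-refl
          ; *ₗ-distribˡ = ·-distribˡ-+
          }
        }
      ; -ᴹ‿cong = -‿cong
      ; -ᴹ‿inverse = -‿inverseˡ , -‿inverseʳ
      }
    }

  private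
    module M  = LeftModule leftModule
    module M+ = CommutativeSemigroupProperties
      (CommutativeMonoid.commutativeSemigroup M.+ᴹ-commutativeMonoid)
    open SetoidReasoning (CommutativeMonoid.setoid M.+ᴹ-commutativeMonoid)

  0∷-+ : ∀ p q → R.0# ∷ (p + q) ≈ (R.0# ∷ p) + (R.0# ∷ q)
  0∷-+ p q = ∷-cong (R.sym (R.+-identityʳ R.0#)) ≈-refl

  ·-0∷ : ∀ a p → a · (R.0# ∷ p) ≈ R.0# ∷ a · p
  ·-0∷ a p = ∷-cong (R.zeroʳ a) ≈-refl

  0∷-* : ∀ p q → (R.0# ∷ p) * q ≈ R.0# ∷ p * q
  0∷-* p q = +-cong (·-zeroˡ q) (≈-refl {R.0# ∷ p * q})

  *-zeroʳ : ∀ p → p * [] ≈ []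
  *-zeroʳ []      = ≈-refl
  *-zeroʳ (a ∷ p) = 0∷0≈0 R.refl (*-zeroʳ p)

  *-congˡ : ∀ p {q r} → q ≈ r → p * q ≈ p * r
  *-congˡ []      q≈r = ≈-refl
  *-congˡ (a ∷ p) q≈r = +-cong (·-cong R.refl q≈r) (∷-cong R.refl (*-congˡ p q≈r))

  *-∷ : ∀ p b q → p * (b ∷ q) ≈ b · p + (R.0# ∷ p * q)
  *-∷ []      b q = ≈-sym (0∷0≈0 R.refl ≈-refl)
  *-∷ (a ∷ p) b q = ∷-cong (R.+-congʳ (R.*-comm a b)) (begin
    a · q + p * (b ∷ q)                   ≈⟨ +-cong (≈-refl {a · q}) (*-∷ p b q) ⟩
    a · q + (b · p + (R.0# ∷ p * q))      ≈⟨ M+.x∙yz≈y∙xz (a · q) (b · p) (R.0# ∷ p * q) ⟩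
    b · p + (a · q + (R.0# ∷ p * q))      ∎)

  *-comm : ∀ p q → p * q ≈ q * p
  *-comm []      q = ≈-sym (*-zeroʳ q)
  *-comm (a ∷ p) q = begin
    a · q + (R.0# ∷ p * q)  ≈⟨ +-cong (≈-refl {a · q}) (∷-cong R.refl (*-comm p q)) ⟩
    a · q + (R.0# ∷ q * p)  ≈⟨ *-∷ q a p ⟨
    q * (a ∷ p)             ∎

  *-cong : ∀ {p q r s} → p ≈ q → r ≈ s → p * r ≈ q * s
  *-cong {p} {q} {r} {s} p≈q r≈s = begin
    p * r  ≈⟨ *-congˡ p r≈s ⟩
    p * s  ≈⟨ *-comm p s ⟩
    s * p  ≈⟨ *-congˡ s p≈q ⟩
    s * q  ≈⟨ *-comm s q ⟩
    q * s  ∎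

  *-distribˡ-+ : ∀ p q r → p * (q + r) ≈ p * q + p * r
  *-distribˡ-+ []      q r = ≈-refl
  *-distribˡ-+ (a ∷ p) q r = begin
    a · (q + r) + (R.0# ∷ p * (q + r))
      ≈⟨ +-cong (·-distribˡ-+ a q r)
           (≈-trans (∷-cong R.refl (*-distribˡ-+ p q r)) (0∷-+ (p * q) (p * r))) ⟩
    (a · q + a · r) + ((R.0# ∷ p * q) + (R.0# ∷ p * r))
      ≈⟨ M+.interchange (a · q) (a · r) (R.0# ∷ p * q) (R.0# ∷ p * r) ⟩
    (a · q + (R.0# ∷ p * q)) + (a · r + (R.0# ∷ p * r))  ∎

  *-distribʳ-+ : ∀ p q r → (q + r) * p ≈ q * p + r * p
  *-distribʳ-+ p q r = begin
    (q + r) * p    ≈⟨ *-comm (q + r) p ⟩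
    p * (q + r)    ≈⟨ *-distribˡ-+ p q r ⟩
    p * q + p * r  ≈⟨ +-cong (*-comm p q) (*-comm p r) ⟩
    q * p + r * p  ∎

  ·-*-assoc : ∀ a p q → a · p * q ≈ a · (p * q)
  ·-*-assoc a []      q = ≈-refl
  ·-*-assoc a (b ∷ p) q = begin
    (a R.* b) · q + (R.0# ∷ a · p * q)
      ≈⟨ +-cong (·-assoc a b q) (∷-cong R.refl (·-*-assoc a p q)) ⟩
    a · (b · q) + (R.0# ∷ a · (p * q))
      ≈⟨ +-cong (≈-refl {a · (b · q)}) (·-0∷ a (p * q)) ⟨
    a · (b · q) + a · (R.0# ∷ p * q)
      ≈⟨ ·-distribˡ-+ a (b · q) (R.0# ∷ p * q) ⟨
    a · (b · q + (R.0# ∷ p * q))  ∎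

  *-assoc : ∀ p q r → (p * q) * r ≈ p * (q * r)
  *-assoc []      q r = ≈-refl
  *-assoc (a ∷ p) q r = begin
    (a · q + (R.0# ∷ p * q)) * r
      ≈⟨ *-distribʳ-+ r (a · q) (R.0# ∷ p * q) ⟩
    a · q * r + (R.0# ∷ p * q) * r
      ≈⟨ +-cong (·-*-assoc a q r) (0∷-* (p * q) r) ⟩
    a · (q * r) + (R.0# ∷ (p * q) * r)
      ≈⟨ +-cong (≈-refl {a · (q * r)}) (∷-cong R.refl (*-assoc p q r)) ⟩
    a · (q * r) + (R.0# ∷ p * (q * r))  ∎

  *-identityˡ : ∀ p → 1ₚ * p ≈ p
  *-identityˡ p = begin
    R.1# · p + (R.0# ∷ [])  ≈⟨ +-cong (·-identityˡ p) (0∷0≈0 R.refl ≈-refl) ⟩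
    p + []                  ≈⟨ +-identityʳ p ⟩
    p                       ∎

  *-identityʳ : ∀ p → p * 1ₚ ≈ p
  *-identityʳ p = ≈-trans (*-comm p 1ₚ) (*-identityˡ p)

  ring : CommutativeRing c ℓ
  ring = record
    { Carrier = Poly ; _≈_ = _≈_ ; _+_ = _+_ ; _*_ = _*_ ; -_ = -_ ; 0# = 0ₚ ; 1# = 1ₚ
    ; isCommutativeRing = record
      { isRing = record
        { +-isAbelianGroup = M.+ᴹ-isAbelianGroup
        ; *-cong = *-cong
        ; *-assoc = *-assoc
        ; *-identity = *-identityˡ , *-identityʳ
        ; distrib = *-distribˡ-+ , *-distribʳ-+
        }
      ; *-comm = *-comm
      }
    }

  module _ (isStableDomain : IsStableDomain R) where

    open IsStableDomain isStableDomain

    private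
      stable : ∀ p q → ¬ ¬ (p ≈ q) → p ≈ q
      stable p q ¬¬p≈q = coeffs λ i →
        ≈-stable (coeff p i) (coeff q i) λ ¬eq → ¬¬p≈q λ p≈q → ¬eq (coeff-≈ p≈q i)

      cancel : ∀ p q → p * q ≈ [] → ¬ (p ≈ []) → q ≈ []
      cancel-≉ : ∀ a p q → ¬ (a R.≈ R.0#) → (a ∷ p) * q ≈ [] → q ≈ []

      cancel []      q pq≈0 p≉0 = ⊥-elim (p≉0 ≈-refl)
      cancel (a ∷ p) q pq≈0 p≉0 = stable q [] λ q≉0 → q≉0 (cancel-≉ a p q
        (λ a≈0 → q≉0 (cancel p q
          (tail≈0 (≈-trans (≈-sym (+-cong (≈-trans (·-cong a≈0 ≈-refl) (·-zeroˡ q))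
            (≈-refl {R.0# ∷ p * q}))) pq≈0))
          (λ p≈0 → p≉0 (0∷0≈0 a≈0 p≈0))))
        pq≈0)

      cancel-≉ a p []      a≉0 pq≈0 = ≈-refl
      cancel-≉ a p (b ∷ q) a≉0 pq≈0 = 0∷0≈0 b≈0 (cancel-≉ a p q a≉0 shifted)
        where
        b≈0 : b R.≈ R.0#
        b≈0 = x*y≈0∧x≉0⇒y≈0 (R.trans (R.sym (R.+-identityʳ (a R.* b))) (coeff-≈ pq≈0 zero)) a≉0
        shifted : (a ∷ p) * q ≈ []
        shifted = tail≈0 (begin
          R.0# ∷ (a ∷ p) * q                       ≈⟨ +-cong (≈-trans (·-cong b≈0 ≈-refl) (·-zeroˡ (a ∷ p)))
                                                        (≈-refl {R.0# ∷ (a ∷ p) * q}) ⟨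
          b · (a ∷ p) + (R.0# ∷ (a ∷ p) * q)       ≈⟨ *-∷ (a ∷ p) b q ⟨
          (a ∷ p) * (b ∷ q)                        ≈⟨ pq≈0 ⟩
          []                                       ∎)

    ring-isStableDomain : IsStableDomain ring
    ring-isStableDomain = record
      { 1≉0 = λ 1≈0 → 1≉0 (coeff-≈ 1≈0 zero)
      ; ≈-stable = stable
      ; x*y≈0∧x≉0⇒y≈0 = λ {p} {q} → cancel p q
      }

record IsField {c ℓ} (R : CommutativeRing c ℓ) : Set (c ⊔ ℓ) where
  open CommutativeRing R
  field
    1≉0     : 1# ≉ 0#
    inverse : ∀ x → x ≉ 0# → ∃[ y ] x * y ≈ 1#

module Fractions {c ℓ} (D : CommutativeRing c ℓ) (isStableDomain : IsStableDomain D) where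

  private
    module D = CommutativeRing D
    module DP = RingProperties D.ring
    open SemiringSolver D.commutativeSemiring using (solve; _:*_; _:+_; _:=_)
    open SetoidReasoning D.setoid
  open IsStableDomain isStableDomain

  record Fraction : Set (c ⊔ ℓ) where
    no-eta-equality
    field
      num   : D.Carrier
      den   : D.Carrier
      den≉0 : den D.≉ D.0#

  open Fraction public

  infix 4 _≈_
  record _≈_ (x y : Fraction) : Set ℓ where
    constructor cross
    field
      cross-≈ : num x D.* den y D.≈ num y D.* den x

  open _≈_ public

  infixl 6 _+_
  infixl 7 _*_
  infix  8 -_

  *-≉0 : ∀ {a b} → a D.≉ D.0# → b D.≉ D.0# → a D.* b D.≉ D.0#
  *-≉0 a≉0 b≉0 ab≈0 = b≉0 (x*y≈0∧x≉0⇒y≈0 ab≈0 a≉0)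

  _+_ _*_ : Fraction → Fraction → Fraction
  num   (x + y) = num x D.* den y D.+ num y D.* den x
  den   (x + y) = den x D.* den y
  den≉0 (x + y) = *-≉0 (den≉0 x) (den≉0 y)
  num   (x * y) = num x D.* num y
  den   (x * y) = den x D.* den y
  den≉0 (x * y) = *-≉0 (den≉0 x) (den≉0 y)

  -_ : Fraction → Fraction
  num   (- x) = D.- num x
  den   (- x) = den x
  den≉0 (- x) = den≉0 x

  embed : D.Carrier → Fraction
  num   (embed a) = a
  den   (embed a) = D.1#
  den≉0 (embed a) = 1≉0

  *-cancelˡ : ∀ a {b d} → a D.≉ D.0# → a D.* b D.≈ a D.* d → b D.≈ d
  *-cancelˡ a {b} {d} a≉0 ab≈ad = DP.x∙y⁻¹≈ε⇒x≈y b d (x*y≈0∧x≉0⇒y≈0 (begin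
    a D.* (b D.- d)        ≈⟨ DP.x[y-z]≈xy-xz a b d ⟩
    a D.* b D.- a D.* d    ≈⟨ D.+-congʳ ab≈ad ⟩
    a D.* d D.- a D.* d    ≈⟨ D.-‿inverseʳ (a D.* d) ⟩
    D.0#                   ∎) a≉0)

  ≈-trans : ∀ {x y z} → x ≈ y → y ≈ z → x ≈ z
  ≈-trans {x} {y} {z} (cross p) (cross q) = cross (*-cancelˡ (den y) (den≉0 y) (begin
    den y D.* (num x D.* den z)  ≈⟨ solve 3 (λ s a u → s :* (a :* u) := (a :* s) :* u)
                                      D.refl (den y) (num x) (den z) ⟩
    (num x D.* den y) D.* den z  ≈⟨ D.*-congʳ p ⟩
    (num y D.* den x) D.* den z  ≈⟨ solve 3 (λ r b u → (r :* b) :* u := (r :* u) :* b)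
                                      D.refl (num y) (den x) (den z) ⟩
    (num y D.* den z) D.* den x  ≈⟨ D.*-congʳ q ⟩
    (num z D.* den y) D.* den x  ≈⟨ solve 3 (λ t s b → (t :* s) :* b := s :* (t :* b))
                                      D.refl (num z) (den y) (den x) ⟩
    den y D.* (num z D.* den x)  ∎))

  +-cong : ∀ {x y u v} → x ≈ y → u ≈ v → x + u ≈ y + v
  +-cong {x} {y} {u} {v} (cross p) (cross q) = cross (begin
    (a D.* f D.+ e D.* b) D.* (d D.* h)
      ≈⟨ solve 6 (λ a b d e f h → (a :* f :+ e :* b) :* (d :* h) :=
           (a :* d) :* (f :* h) :+ (e :* h) :* (b :* d)) D.refl a b d e f h ⟩
    (a D.* d) D.* (f D.* h) D.+ (e D.* h) D.* (b D.* d)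
      ≈⟨ D.+-cong (D.*-congʳ p) (D.*-congʳ q) ⟩
    (k D.* b) D.* (f D.* h) D.+ (g D.* f) D.* (b D.* d)
      ≈⟨ solve 6 (λ k b d g f h → (k :* b) :* (f :* h) :+ (g :* f) :* (b :* d) :=
           (k :* h :+ g :* d) :* (b :* f)) D.refl k b d g f h ⟩
    (k D.* h D.+ g D.* d) D.* (b D.* f)  ∎)
    where
    a = num x
    b = den x
    k = num y
    d = den y
    e = num u
    f = den u
    g = num v
    h = den v

  *-cong : ∀ {x y u v} → x ≈ y → u ≈ v → x * u ≈ y * v
  *-cong {x} {y} {u} {v} (cross p) (cross q) = cross (begin
    (num x D.* num u) D.* (den y D.* den v)  ≈⟨ interchange (num x) (num u) (den y) (den v) ⟩
    (num x D.* den y) D.* (num u D.* den v)  ≈⟨ D.*-cong p q ⟩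
    (num y D.* den x) D.* (num v D.* den u)  ≈⟨ interchange (num y) (den x) (num v) (den u) ⟩
    (num y D.* num v) D.* (den x D.* den u)  ∎)
    where
    interchange : ∀ a b d e → (a D.* b) D.* (d D.* e) D.≈ (a D.* d) D.* (b D.* e)
    interchange = solve 4 (λ a b d e → (a :* b) :* (d :* e) := (a :* d) :* (b :* e)) D.refl

  -‿cong : ∀ {x y} → x ≈ y → - x ≈ - y
  -‿cong {x} {y} (cross p) = cross (begin
    (D.- num x) D.* den y  ≈⟨ DP.-‿distribˡ-* (num x) (den y) ⟨
    D.- (num x D.* den y)  ≈⟨ D.-‿cong p ⟩
    D.- (num y D.* den x)  ≈⟨ DP.-‿distribˡ-* (num y) (den x) ⟩
    (D.- num y) D.* den x  ∎)

  +-comm : ∀ x y → x + y ≈ y + x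
  +-comm x y = cross (D.*-cong (D.+-comm _ _) (D.*-comm (den y) (den x)))

  *-comm : ∀ x y → x * y ≈ y * x
  *-comm x y = cross (D.*-cong (D.*-comm (num x) (num y)) (D.*-comm (den y) (den x)))

  +-assoc : ∀ x y z → (x + y) + z ≈ x + (y + z)
  +-assoc x y z = cross (solve 6 (λ a b d e f g →
    ((a :* e :+ d :* b) :* g :+ f :* (b :* e)) :* (b :* (e :* g)) :=
    (a :* (e :* g) :+ (d :* g :+ f :* e) :* b) :* ((b :* e) :* g)) D.refl
    (num x) (den x) (num y) (den y) (num z) (den z))

  *-assoc : ∀ x y z → (x * y) * z ≈ x * (y * z)
  *-assoc x y z = cross (D.*-cong (D.*-assoc (num x) (num y) (num z))
    (D.sym (D.*-assoc (den x) (den y) (den z))))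

  +-identityˡ : ∀ x → embed D.0# + x ≈ x
  +-identityˡ x = cross (D.*-cong
    (D.trans (D.+-cong (D.zeroˡ (den x)) (D.*-identityʳ (num x))) (D.+-identityˡ (num x)))
    (D.sym (D.*-identityˡ (den x))))

  *-identityˡ : ∀ x → embed D.1# * x ≈ x
  *-identityˡ x = cross (D.*-cong (D.*-identityˡ (num x)) (D.sym (D.*-identityˡ (den x))))

  -‿inverseʳ : ∀ x → x + (- x) ≈ embed D.0#
  -‿inverseʳ x = cross (begin
    (num x D.* den x D.+ (D.- num x) D.* den x) D.* D.1#  ≈⟨ D.*-identityʳ _ ⟩
    num x D.* den x D.+ (D.- num x) D.* den x  ≈⟨ D.distribʳ (den x) (num x) (D.- num x) ⟨
    (num x D.- num x) D.* den x                ≈⟨ D.*-congʳ (D.-‿inverseʳ (num x)) ⟩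
    D.0# D.* den x                             ≈⟨ D.zeroˡ (den x) ⟩
    D.0#                                       ≈⟨ D.zeroˡ (den x D.* den x) ⟨
    D.0# D.* (den x D.* den x)                 ∎)

  *-distribˡ-+ : ∀ x y z → x * (y + z) ≈ x * y + x * z
  *-distribˡ-+ x y z = cross (solve 6 (λ a b d e f g →
    (a :* (d :* g :+ f :* e)) :* ((b :* e) :* (b :* g)) :=
    ((a :* d) :* (b :* g) :+ (a :* f) :* (b :* e)) :* (b :* (e :* g))) D.refl
    (num x) (den x) (num y) (den y) (num z) (den z))

  ≈-refl : ∀ {x} → x ≈ x
  ≈-refl = cross D.refl

  ≈-sym : ∀ {x y} → x ≈ y → y ≈ x
  ≈-sym (cross p) = cross (D.sym p)

  ring : CommutativeRing (c ⊔ ℓ) ℓ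
  ring = record
    { Carrier = Fraction ; _≈_ = _≈_ ; _+_ = _+_ ; _*_ = _*_ ; -_ = -_
    ; 0# = embed D.0# ; 1# = embed D.1#
    ; isCommutativeRing = record
      { isRing = record
        { +-isAbelianGroup = record
          { isGroup = record
            { isMonoid = record
              { isSemigroup = record
                { isMagma = record
                  { isEquivalence = record { refl = ≈-refl ; sym = ≈-sym ; trans = ≈-trans }
                  ; ∙-cong = +-cong
                  }
                ; assoc = +-assoc
                }
              ; identity = +-identityˡ , λ x → ≈-trans (+-comm x _) (+-identityˡ x)
              }
            ; inverse = (λ x → ≈-trans (+-comm (- x) x) (-‿inverseʳ x)) , -‿inverseʳ
            ; ⁻¹-cong = -‿cong
            }
          ; comm = +-comm
          }
        ; *-cong = *-cong
        ; *-assoc = *-assoc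
        ; *-identity = *-identityˡ , λ x → ≈-trans (*-comm x _) (*-identityˡ x)
        ; distrib = *-distribˡ-+ , λ x y z → ≈-trans (*-comm (y + z) x)
            (≈-trans (*-distribˡ-+ x y z) (+-cong (*-comm x y) (*-comm x z)))
        }
      ; *-comm = *-comm
      }
    }

  isField : IsField ring
  isField = record
    { 1≉0 = λ (cross p) → 1≉0 (D.trans (D.sym (D.*-identityʳ D.1#))
        (D.trans p (D.*-identityʳ D.0#)))
    ; inverse = λ x x≉0 →
        record { num = den x ; den = num x
               ; den≉0 = λ n≈0 → x≉0 (cross (D.trans (D.*-identityʳ (num x))
                   (D.trans n≈0 (D.sym (D.zeroˡ (den x))))))
               }
      , cross (D.trans (D.*-identityʳ _) (D.trans (D.*-comm (num x) (den x))
          (D.sym (D.*-identityˡ _))))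
    }

stirling₂ : ℕ → ℕ → ℕ
stirling₂ zero    zero    = 1
stirling₂ zero    (suc k) = 0
stirling₂ (suc n) zero    = 0
stirling₂ (suc n) (suc k) = suc k ℕ.* stirling₂ n (suc k) ℕ.+ stirling₂ n k

module TannyDowling {c ℓ} (R : CommutativeRing c ℓ) where

  private
    module R = CommutativeRing R
    module RawR = RawSemiringOps (Semiring.rawSemiring R.semiring)
  open Polynomials R using (Poly; X; _·_; ring)
  private
    module RawPoly = RawSemiringOps (Semiring.rawSemiring (CommutativeRing.semiring ring))

  -- The index i, k ≤ i ≤ n, is written as k + j with 0 ≤ j < suc n ∸ k.
  whitney₂ : R.Carrier → ℕ → ℕ → R.Carrier
  whitney₂ m n k = RawR.sum {suc n ℕ.∸ k} λ j → term (k ℕ.+ toℕ j)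
    where
    term : ℕ → R.Carrier
    term i = (n C i) RawR.× (m RawR.^ (i ℕ.∸ k) R.* (stirling₂ i k RawR.× R.1#))

  tannyDowling : R.Carrier → ℕ → Poly
  tannyDowling m n = RawPoly.sum {suc n} λ k →
    (toℕ k !) RawPoly.× (whitney₂ m n (toℕ k) · X RawPoly.^ toℕ k)

module OrthogonalPolynomials {c ℓ} (K : CommutativeRing c ℓ) where

  private
    module K = CommutativeRing K
  open Polynomials K
  open RawSemiringOps (Semiring.rawSemiring (CommutativeRing.semiring ring)) using (_^_)
  open LeftModuleMorphisms (LeftModule.rawLeftModule leftModule)
    (LeftModule.rawLeftModule (TensorUnit.leftModule {R = K.ring}))
    using (IsLeftModuleHomomorphism)

  record IsOrthogonalFamily (P : ℕ → Poly) (𝓛 : Poly → K.Carrier) : Set (c ⊔ ℓ) where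
    field
      monic         : ∀ n → IsMonicOfDegree n (P n)
      linear        : IsLeftModuleHomomorphism 𝓛
      normalised    : 𝓛 1ₚ K.≈ K.1#
      orthogonal    : ∀ i j → i ≢ j → 𝓛 (P i * P j) K.≈ K.0#
      nondegenerate : ∀ n → 𝓛 (P n * P n) K.≉ K.0#

  IsOrthogonalMomentSequence : (ℕ → K.Carrier) → Set (c ⊔ ℓ)
  IsOrthogonalMomentSequence μ =
    ∃[ P ] ∃[ 𝓛 ] (IsOrthogonalFamily P 𝓛 × (∀ n → 𝓛 (X ^ n) K.≈ μ n))

open ComplexNumbers public using (ℂ)

module ℂ[x] = Polynomials ComplexNumbers.ring

-- The field ℂ(x); see ℂ⟨x⟩.isField.
module ℂ⟨x⟩ = Fractions ℂ[x].ring (ℂ[x].ring-isStableDomain ComplexNumbers.isStableDomain)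

open TannyDowling ComplexNumbers.ring public using (tannyDowling)
open OrthogonalPolynomials ℂ⟨x⟩.ring public using (IsOrthogonalMomentSequence)

{-# OPTIONS --safe #-}

-- With u = (e^{mz} − 1)/m (read as z if m = 0) the moments have exponential generating
-- function g = e^z/(1 − x u).  For f = u/(1 − x u) the series g f^k/k! satisfy
--   (g f^k/k!)′ = g f^{k−1}/(k−1)! + β_k g f^k/k! + γ_k g f^{k+1}/(k+1)!
-- with β_k = 1 + m k + (2k + 1) x and γ_k = (k + 1)² x (x + m).  Hence the monic polynomials with
--   P_{k+1} = (z − β_k) P_k − γ_{k−1} P_{k−1}
-- satisfy 𝓛(zⁿ P_k) = γ_0 ⋯ γ_{k−1} a(n,k), where a(n,k) is the coefficient of zⁿ/n! in g f^k/k!.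
-- Since a is unitriangular, the P_k are orthogonal with 𝓛(P_k²) = γ_0 ⋯ γ_{k−1}, and γ_k ≠ 0 for
-- every m because x is transcendental.  Expanding in powers of u gives
-- a(n,k) = Σ_i W_m(n,i) L(i,k), where L(i,k) = C(i,k) x^{i−k} i!/k!.
module Submission where

open import Defs
open import Algebra.Bundles using (CommutativeRing; Semiring)
import Algebra.Definitions.RawSemiring as RawSemiringOps
import Algebra.Properties.Group as GroupProperties
import Algebra.Properties.Ring as RingProperties
import Algebra.Properties.Semiring.Mult as Mult
import Algebra.Properties.Semiring.Sum as Sum
import Algebra.Solver.Ring.NaturalCoefficients.Default as SemiringSolver
open import Data.Empty using (⊥-elim)
open import Data.Fin.Base using (toℕ)
open import Data.List.Base using ([]; _∷_)
open import Data.Nat.Base as ℕ using (ℕ; zero; suc; _!)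
open import Data.Nat.Combinatorics using (_C_; nCk+nC[k+1]≡[n+1]C[k+1]; k>n⇒nCk≡0)
import Data.Nat.Properties as ℕ
open import Data.Product.Base using (_,_; proj₁; proj₂)
open import Data.Rational.Base as ℚ using (0ℚ; 1ℚ)
import Data.Rational.Properties as ℚ
open import Function.Base using (_∘_)
open import Relation.Binary.Definitions using (tri<; tri≈; tri>)
import Relation.Binary.Reasoning.Setoid as SetoidReasoning
open import Relation.Binary.PropositionalEquality as ≡ using (_≡_; _≢_)
open import Relation.Nullary using (yes; no)

-- Finite sums and binomial transforms in a commutative ring.

module Sequences {c ℓ} (R : CommutativeRing c ℓ) where

  open CommutativeRing R
  private
    module M = Mult semiring
    module S = Sum semiring
  open RawSemiringOps (Semiring.rawSemiring semiring) using (_×_)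
  open SemiringSolver commutativeSemiring using (solve; _:+_; _:=_)
  open SetoidReasoning setoid

  ι : ℕ → Carrier
  ι n = n × 1#

  -- With the junk value 0 at index 0, three-term recurrences hold uniformly.
  prev : (ℕ → Carrier) → ℕ → Carrier
  prev f zero    = 0#
  prev f (suc k) = f k

  ∑ : ℕ → (ℕ → Carrier) → Carrier
  ∑ n f = S.sum {n} (f ∘ toℕ)

  ∑-cong : ∀ n {f g} → (∀ i → f i ≈ g i) → ∑ n f ≈ ∑ n g
  ∑-cong n f≈g = S.sum-cong-≋ {n} (f≈g ∘ toℕ)

  ∑-+ : ∀ n f g → ∑ n (λ i → f i + g i) ≈ ∑ n f + ∑ n g
  ∑-+ n f g = S.∑-distrib-+ {n} (f ∘ toℕ) (g ∘ toℕ)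

  ∑-*ˡ : ∀ n x f → ∑ n (λ i → x * f i) ≈ x * ∑ n f
  ∑-*ˡ n x f = sym (S.*-distribˡ-sum {n} x (f ∘ toℕ))

  ∑-last : ∀ n f → ∑ (suc n) f ≈ ∑ n f + f n
  ∑-last zero    f = trans (+-identityʳ (f 0)) (sym (+-identityˡ (f 0)))
  ∑-last (suc n) f = trans (+-congˡ (∑-last n (f ∘ suc))) (sym (+-assoc _ _ _))

  -- Turns a sum starting at `k`, the form in which `whitney₂` is defined, into one starting at 0.
  -- Truncated subtraction is harmless: once `k` exceeds `n`, both sides vanish.
  ∑-drop : ∀ n k f → (∀ i → i ℕ.< k → f i ≈ 0#) → ∑ (n ℕ.∸ k) (λ j → f (k ℕ.+ j)) ≈ ∑ n f
  ∑-drop n       zero    f f≈0 = refl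
  ∑-drop zero    (suc k) f f≈0 = refl
  ∑-drop (suc n) (suc k) f f≈0 = begin
    ∑ (n ℕ.∸ k) (λ j → f (suc k ℕ.+ j))  ≈⟨ ∑-drop n k (f ∘ suc) (λ i i<k → f≈0 (suc i) (ℕ.s<s i<k)) ⟩
    ∑ n (f ∘ suc)                        ≈⟨ +-identityˡ _ ⟨
    0# + ∑ n (f ∘ suc)                   ≈⟨ +-congʳ (f≈0 0 ℕ.z<s) ⟨
    f 0 + ∑ n (f ∘ suc)                  ∎

  -- On exponential generating functions this is multiplication by `e^z`.
  binomialTransform : (ℕ → Carrier) → ℕ → Carrier
  binomialTransform f n = ∑ (suc n) (λ i → (n C i) × f i)

  binomialTransform-cong : ∀ {f g} n → (∀ i → f i ≈ g i) →
    binomialTransform f n ≈ binomialTransform g n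
  binomialTransform-cong n f≈g = ∑-cong (suc n) (λ i → M.×-congʳ (n C i) (f≈g i))

  binomialTransform-+ : ∀ f g n →
    binomialTransform (λ i → f i + g i) n ≈ binomialTransform f n + binomialTransform g n
  binomialTransform-+ f g n = trans
    (∑-cong (suc n) (λ i → ×-+ (n C i) (f i) (g i)))
    (∑-+ (suc n) (λ i → (n C i) × f i) (λ i → (n C i) × g i))
    where
    ×-+ : ∀ m x y → m × (x + y) ≈ m × x + m × y
    ×-+ zero    x y = sym (+-identityˡ 0#)
    ×-+ (suc m) x y = trans (+-congˡ (×-+ m x y))
      (solve 4 (λ x y a b → (x :+ y) :+ (a :+ b) := (x :+ a) :+ (y :+ b)) refl x y (m × x) (m × y))

  binomialTransform-*ˡ : ∀ x f n →
    binomialTransform (λ i → x * f i) n ≈ x * binomialTransform f n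
  binomialTransform-*ˡ x f n = trans
    (∑-cong (suc n) (λ i → sym (M.×-comm-* (n C i) x (f i))))
    (∑-*ˡ (suc n) x (λ i → (n C i) × f i))

  binomialTransform-zero : ∀ n → binomialTransform (λ _ → 0#) n ≈ 0#
  binomialTransform-zero n = trans
    (binomialTransform-cong n (λ _ → sym (zeroˡ 0#)))
    (trans (binomialTransform-*ˡ 0# (λ _ → 0#) n) (zeroˡ _))

  -- Pascal's rule; in generating functions, with the shift as derivative,
  -- `(e^z F)′ = e^z F + e^z F′`.
  binomialTransform-suc : ∀ f n →
    binomialTransform f (suc n) ≈ binomialTransform f n + binomialTransform (f ∘ suc) n
  binomialTransform-suc f n = begin
    1 × f 0 + ∑ (suc n) (λ i → (suc n C suc i) × f (suc i))
      ≈⟨ +-congˡ (∑-cong (suc n) (λ i → trans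
           (M.×-congˡ {f (suc i)} (≡.sym (nCk+nC[k+1]≡[n+1]C[k+1] n i)))
           (M.×-homo-+ (f (suc i)) (n C i) (n C suc i)))) ⟩
    1 × f 0 + ∑ (suc n) (λ i → (n C i) × f (suc i) + (n C suc i) × f (suc i))
      ≈⟨ +-congˡ (∑-+ (suc n) (λ i → (n C i) × f (suc i)) (λ i → (n C suc i) × f (suc i))) ⟩
    1 × f 0 + (binomialTransform (f ∘ suc) n + ∑ (suc n) (λ i → (n C suc i) × f (suc i)))
      ≈⟨ solve 3 (λ a b c → a :+ (b :+ c) := (a :+ c) :+ b) refl _ _ _ ⟩
    ∑ (suc (suc n)) (λ i → (n C i) × f i) + binomialTransform (f ∘ suc) n
      ≈⟨ +-congʳ (∑-last (suc n) (λ i → (n C i) × f i)) ⟩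
    (binomialTransform f n + (n C suc n) × f (suc n)) + binomialTransform (f ∘ suc) n
      -- Pascal's rule made the sum run one index too far; the surplus term carries `C(n,n+1) = 0`.
      ≈⟨ +-congʳ (+-congˡ (M.×-congˡ {f (suc n)} (k>n⇒nCk≡0 (ℕ.n<1+n n)))) ⟩
    (binomialTransform f n + 0#) + binomialTransform (f ∘ suc) n
      ≈⟨ +-congʳ (+-identityʳ _) ⟩
    binomialTransform f n + binomialTransform (f ∘ suc) n
      ∎

-- Whitney numbers by recurrence, and agreement with the defining sum.

module Whitney {c ℓ} (R : CommutativeRing c ℓ) (m : CommutativeRing.Carrier R) where

  open CommutativeRing R
  open Sequences R
  open RawSemiringOps (Semiring.rawSemiring semiring) using (_×_; _^_)
  private
    module M = Mult semiring
  open SemiringSolver commutativeSemiring using (solve; con; _:*_; _:+_; _:=_)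
  open SetoidReasoning setoid
  open TannyDowling R using (whitney₂)

  -- Coefficients of `e^z u^k / k!`. The recurrence is its derivative, computed with `u′ = 1 + m u`,
  -- and is valid also for `m = 0`.
  whitney : ℕ → ℕ → Carrier
  whitney zero    zero    = 1#
  whitney zero    (suc k) = 0#
  whitney (suc n) k       = (1# + m * ι k) * whitney n k + prev (whitney n) k

  whitney≈0 : ∀ n k → n ℕ.< k → whitney n k ≈ 0#
  whitney≈0 zero    (suc k) _     = refl
  whitney≈0 (suc n) (suc k) n+1<k+1 = begin
    (1# + m * ι (suc k)) * whitney n (suc k) + whitney n k
      ≈⟨ +-cong (*-congˡ (whitney≈0 n (suc k) (ℕ.m<n⇒m<1+n n<k))) (whitney≈0 n k n<k) ⟩
    (1# + m * ι (suc k)) * 0# + 0#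
      ≈⟨ trans (+-identityʳ _) (zeroʳ _) ⟩
    0# ∎
    where n<k = ℕ.s<s⁻¹ n+1<k+1

  -- Coefficients of `u^k / k!`. For `i < k` the truncated exponent is 0, and the Stirling number
  -- makes the product vanish.
  stirling : ℕ → ℕ → Carrier
  stirling i k = m ^ (i ℕ.∸ k) * ι (stirling₂ i k)

  stirling₂≡0 : ∀ i k → i ℕ.< k → stirling₂ i k ≡ 0
  stirling₂≡0 zero    (suc k) _ = ≡.refl
  stirling₂≡0 (suc i) (suc k) i+1<k+1
    rewrite stirling₂≡0 i (suc k) (ℕ.m<n⇒m<1+n (ℕ.s<s⁻¹ i+1<k+1))
          | stirling₂≡0 i k (ℕ.s<s⁻¹ i+1<k+1)
          | ℕ.*-zeroʳ k = ≡.refl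

  stirling≈0 : ∀ i k → i ℕ.< k → stirling i k ≈ 0#
  stirling≈0 i k i<k = trans (*-congˡ (reflexive (≡.cong ι (stirling₂≡0 i k i<k)))) (zeroʳ _)

  -- The derivative of `u^k / k!`, again by `u′ = 1 + m u`.
  stirling-suc : ∀ i k → stirling (suc i) k ≈ m * ι k * stirling i k + prev (stirling i) k
  stirling-suc i zero    = begin
    m ^ suc i * 0#                     ≈⟨ zeroʳ _ ⟩
    0#                                 ≈⟨ zeroˡ _ ⟨
    0# * stirling i 0                  ≈⟨ *-congʳ (zeroʳ m) ⟨
    m * 0# * stirling i 0              ≈⟨ +-identityʳ _ ⟨
    m * 0# * stirling i 0 + 0#         ∎
  stirling-suc i (suc k) = begin
    p * ι (suc k ℕ.* s ℕ.+ stirling₂ i k)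
      ≈⟨ *-congˡ (trans (M.×-homo-+ 1# (suc k ℕ.* s) (stirling₂ i k)) (+-congʳ (M.×1-homo-* (suc k) s))) ⟩
    p * (ι (suc k) * ι s + ι (stirling₂ i k))
      ≈⟨ solve 4 (λ p k s t → p :* (k :* s :+ t) := k :* (p :* s) :+ p :* t) refl
           p (ι (suc k)) (ι s) (ι (stirling₂ i k)) ⟩
    ι (suc k) * (p * ι s) + p * ι (stirling₂ i k)
      ≈⟨ +-congʳ (*-congˡ shift) ⟩
    ι (suc k) * (m * stirling i (suc k)) + p * ι (stirling₂ i k)
      ≈⟨ +-congʳ (solve 3 (λ k m t → k :* (m :* t) := m :* k :* t) refl (ι (suc k)) m (stirling i (suc k))) ⟩
    m * ι (suc k) * stirling i (suc k) + stirling i k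
      ∎
    where
    p = m ^ (i ℕ.∸ k)
    s = stirling₂ i (suc k)
    -- A factor `m` can be split off the power only when `k < i`; otherwise `S(i,k+1) = 0` and both
    -- sides vanish.
    shift : p * ι s ≈ m * stirling i (suc k)
    shift with k ℕ.<? i
    ... | yes k<i = begin
      m ^ (i ℕ.∸ k) * ι s                ≈⟨ *-congʳ (reflexive (≡.cong (m ^_) (ℕ.+-∸-assoc 1 k<i))) ⟩
      m ^ suc (i ℕ.∸ suc k) * ι s        ≈⟨ *-assoc _ _ _ ⟩
      m * stirling i (suc k)             ∎
    ... | no k≮i = begin
      p * ι s                            ≈⟨ *-congˡ (reflexive (≡.cong ι (stirling₂≡0 i (suc k) i<k+1))) ⟩
      p * 0#                             ≈⟨ zeroʳ p ⟩
      0#                                 ≈⟨ zeroʳ m ⟨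
      m * 0#                             ≈⟨ *-congˡ (stirling≈0 i (suc k) i<k+1) ⟨
      m * stirling i (suc k)             ∎
      where i<k+1 = ℕ.s≤s (ℕ.≮⇒≥ k≮i)

  -- Both sides obey the same recurrence: in the factor `1 + m k`, the `1` comes from
  -- `binomialTransform-suc` (the derivative of `e^z`) and the `m k` from `stirling-suc`.
  stirlingTransform≈whitney : ∀ n k → binomialTransform (λ i → stirling i k) n ≈ whitney n k
  stirlingTransform≈whitney zero    zero    = begin
    (1# * (1# + 0#) + 0#) + 0#
      ≈⟨ solve 0 ((con 1 :* (con 1 :+ con 0) :+ con 0) :+ con 0 := con 1) refl ⟩
    1# ∎
  stirlingTransform≈whitney zero    (suc k) = begin
    (1# * 0# + 0#) + 0#
      ≈⟨ solve 0 ((con 1 :* con 0 :+ con 0) :+ con 0 := con 0) refl ⟩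
    0# ∎
  stirlingTransform≈whitney (suc n) k       = begin
    binomialTransform (λ i → stirling i k) (suc n)
      ≈⟨ binomialTransform-suc (λ i → stirling i k) n ⟩
    binomialTransform (λ i → stirling i k) n + binomialTransform (λ i → stirling (suc i) k) n
      ≈⟨ +-congˡ (binomialTransform-cong n (λ i → stirling-suc i k)) ⟩
    binomialTransform (λ i → stirling i k) n
      + binomialTransform (λ i → m * ι k * stirling i k + prev (stirling i) k) n
      ≈⟨ +-congˡ (binomialTransform-+ (λ i → m * ι k * stirling i k) (λ i → prev (stirling i) k) n) ⟩
    binomialTransform (λ i → stirling i k) n
      + (binomialTransform (λ i → m * ι k * stirling i k) n + binomialTransform (λ i → prev (stirling i) k) n)
      ≈⟨ +-congˡ (+-congʳ (binomialTransform-*ˡ (m * ι k) (λ i → stirling i k) n)) ⟩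
    binomialTransform (λ i → stirling i k) n
      + (m * ι k * binomialTransform (λ i → stirling i k) n + binomialTransform (λ i → prev (stirling i) k) n)
      ≈⟨ +-cong (stirlingTransform≈whitney n k)
           (+-cong (*-congˡ (stirlingTransform≈whitney n k)) (transform-prev k)) ⟩
    whitney n k + (m * ι k * whitney n k + prev (whitney n) k)
      ≈⟨ solve 3 (λ w a p → w :+ (a :* w :+ p) := (con 1 :+ a) :* w :+ p) refl
           (whitney n k) (m * ι k) (prev (whitney n) k) ⟩
    (1# + m * ι k) * whitney n k + prev (whitney n) k
      ∎
    where
    transform-prev : ∀ k → binomialTransform (λ i → prev (stirling i) k) n ≈ prev (whitney n) k
    transform-prev zero    = binomialTransform-zero n
    transform-prev (suc k) = stirlingTransform≈whitney n k

  whitney₂≈whitney : ∀ n k → whitney₂ m n k ≈ whitney n k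
  whitney₂≈whitney n k = trans
    (∑-drop (suc n) k (λ i → (n C i) × stirling i k) λ i i<k → trans
      (M.×-congʳ (n C i) (stirling≈0 i k i<k))
      -- A multiple of `0#` vanishes: write `0#` as `0# * 0#` and move one factor outside.
      (trans (sym (M.×-congʳ (n C i) (zeroˡ 0#))) (trans (sym (M.×-comm-* (n C i) 0# 0#)) (zeroˡ _))))
    (stirlingTransform≈whitney n k)

-- Laguerre coefficients and the three-term recurrence of the moment array.

module Moments {c ℓ} (R : CommutativeRing c ℓ) (m x : CommutativeRing.Carrier R) where

  open CommutativeRing R
  open Sequences R
  open Whitney R m using (whitney; whitney≈0)
  open RawSemiringOps (Semiring.rawSemiring semiring) using (_×_; _^_)
  private
    module M = Mult semiring
    module G = GroupProperties +-group
  open SemiringSolver commutativeSemiring using (solve; con; _:*_; _:+_; _:=_)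
  open SetoidReasoning setoid

  tannyDowlingSum : ℕ → Carrier
  tannyDowlingSum n = ∑ (suc n) λ k → (k !) × (whitney n k * x ^ k)

  β γ : ℕ → Carrier
  β k = 1# + m * ι k + (ι k + ι (suc k)) * x
  γ k = ι (suc k) * ι (suc k) * (x * (x + m))

  -- laguerre i k = C(i,k) x^{i−k} i!/k!, by a recurrence free of division and subtraction.
  laguerre : ℕ → ℕ → Carrier
  laguerre zero    zero    = 1#
  laguerre zero    (suc k) = 0#
  laguerre (suc i) k       = prev (laguerre i) k + (ι i + ι (suc k)) * x * laguerre i k

  -- (i − k) L(i,k) = (k + 1)² x L(i,k+1), with the subtraction moved across.
  laguerre-contiguous : ∀ i k →
    ι i * laguerre i k ≈ ι k * laguerre i k + ι (suc k) * ι (suc k) * x * laguerre i (suc k)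
  laguerre-contiguous zero    zero    =
    solve 1 (λ x → con 0 :* con 1 := con 0 :* con 1 :+ (con 1 :+ con 0) :* (con 1 :+ con 0) :* x :* con 0) refl x
  laguerre-contiguous zero    (suc k) =
    solve 2 (λ x k → con 0 :* con 0 :=
      (con 1 :+ k) :* con 0 :+ (con 1 :+ (con 1 :+ k)) :* (con 1 :+ (con 1 :+ k)) :* x :* con 0) refl x (ι k)
  laguerre-contiguous (suc i) zero    = begin
    (1# + ι i) * (0# + (ι i + (1# + 0#)) * x * l₀)
      -- The identity `(i + 1)² = 1 + (i + 2) i` exposes `ι i * l₀` for the induction hypothesis.
      ≈⟨ solve 3 (λ i x a → (con 1 :+ i) :* (con 0 :+ (i :+ (con 1 :+ con 0)) :* x :* a) :=
           x :* a :+ (i :+ con 2) :* x :* (i :* a)) refl (ι i) x l₀ ⟩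
    x * l₀ + (ι i + (1# + 1#)) * x * (ι i * l₀)
      ≈⟨ +-congˡ (*-congˡ (laguerre-contiguous i 0)) ⟩
    x * l₀ + (ι i + (1# + 1#)) * x * (0# * l₀ + (1# + 0#) * (1# + 0#) * x * l₁)
      ≈⟨ solve 4 (λ i x a b →
           x :* a :+ (i :+ con 2) :* x :* (con 0 :* a :+ (con 1 :+ con 0) :* (con 1 :+ con 0) :* x :* b) :=
           con 0 :* (con 0 :+ (i :+ (con 1 :+ con 0)) :* x :* a) :+
           (con 1 :+ con 0) :* (con 1 :+ con 0) :* x :*
             (a :+ (i :+ (con 1 :+ (con 1 :+ con 0))) :* x :* b)) refl (ι i) x l₀ l₁ ⟩
    0# * (0# + (ι i + (1# + 0#)) * x * l₀) +
      (1# + 0#) * (1# + 0#) * x * (l₀ + (ι i + (1# + (1# + 0#))) * x * l₁)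
      ∎
    where
    l₀ = laguerre i 0
    l₁ = laguerre i 1
  -- The hypothesis at `(i, k + 1)`, scaled by `(i + k + 3) x`, produces the required `l₂` but also
  -- a multiple of `(k + 1) l₁`. Instead of subtracting, that multiple is added to both sides and
  -- cancelled at the end.
  laguerre-contiguous (suc i) (suc k) = G.∙-cancelʳ ((I + K + three) * x * ((1# + K) * l₁)) _ _ (begin
    (1# + I) * (l₀ + (I + (1# + (1# + K))) * x * l₁) + (I + K + three) * x * ((1# + K) * l₁)
      ≈⟨ solve 5 (λ i k x a b →
           (con 1 :+ i) :* (a :+ (i :+ (con 1 :+ (con 1 :+ k))) :* x :* b) :+
             (i :+ k :+ con 3) :* x :* ((con 1 :+ k) :* b) :=
           i :* a :+ (a :+ ((con 1 :+ i) :* (i :+ k :+ con 2) :+ (i :+ k :+ con 3) :* (con 1 :+ k)) :* x :* b))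
           refl I K x l₀ l₁ ⟩
    I * l₀ + (l₀ + ((1# + I) * (I + K + (1# + 1#)) + (I + K + three) * (1# + K)) * x * l₁)
      ≈⟨ +-congʳ (laguerre-contiguous i k) ⟩
    (K * l₀ + (1# + K) * (1# + K) * x * l₁)
      + (l₀ + ((1# + I) * (I + K + (1# + 1#)) + (I + K + three) * (1# + K)) * x * l₁)
      ≈⟨ solve 5 (λ i k x a b →
           (k :* a :+ (con 1 :+ k) :* (con 1 :+ k) :* x :* b)
           :+ (a :+ ((con 1 :+ i) :* (i :+ k :+ con 2) :+ (i :+ k :+ con 3) :* (con 1 :+ k)) :* x :* b) :=
           (con 1 :+ k) :* a :+ ((con 1 :+ k) :* (i :+ k :+ con 2) :+ (k :+ con 2) :* (k :+ con 2)) :* x :* b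
           :+ (i :+ k :+ con 3) :* x :* (i :* b)) refl I K x l₀ l₁ ⟩
    (1# + K) * l₀ + ((1# + K) * (I + K + (1# + 1#)) + (K + (1# + 1#)) * (K + (1# + 1#))) * x * l₁
      + (I + K + three) * x * (I * l₁)
      ≈⟨ +-congˡ (*-congˡ (laguerre-contiguous i (suc k))) ⟩
    (1# + K) * l₀ + ((1# + K) * (I + K + (1# + 1#)) + (K + (1# + 1#)) * (K + (1# + 1#))) * x * l₁
      + (I + K + three) * x * ((1# + K) * l₁ + (1# + (1# + K)) * (1# + (1# + K)) * x * l₂)
      ≈⟨ solve 6 (λ i k x a b c →
           (con 1 :+ k) :* a :+ ((con 1 :+ k) :* (i :+ k :+ con 2) :+ (k :+ con 2) :* (k :+ con 2)) :* x :* b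
           :+ (i :+ k :+ con 3) :* x :* ((con 1 :+ k) :* b :+ (con 1 :+ (con 1 :+ k)) :* (con 1 :+ (con 1 :+ k)) :* x :* c) :=
           ((con 1 :+ k) :* (a :+ (i :+ (con 1 :+ (con 1 :+ k))) :* x :* b) :+
            (con 1 :+ (con 1 :+ k)) :* (con 1 :+ (con 1 :+ k)) :* x :*
              (b :+ (i :+ (con 1 :+ (con 1 :+ (con 1 :+ k)))) :* x :* c))
           :+ (i :+ k :+ con 3) :* x :* ((con 1 :+ k) :* b)) refl I K x l₀ l₁ l₂ ⟩
    _ ∎)
    where
    I = ι i
    K = ι k
    l₀ = laguerre i k
    l₁ = laguerre i (suc k)
    l₂ = laguerre i (suc (suc k))
    three = 1# + 1# + 1#

  -- Column 0 supplies the weights `i! x^i` of the Tanny-Dowling polynomials.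
  laguerre-zero : ∀ i → laguerre i 0 ≈ (i !) × (x ^ i)
  laguerre-zero zero    = sym (+-identityʳ 1#)
  laguerre-zero (suc i) = begin
    0# + (ι i + (1# + 0#)) * x * laguerre i 0
      ≈⟨ solve 3 (λ i x a → con 0 :+ (i :+ (con 1 :+ con 0)) :* x :* a := (con 1 :+ i) :* (x :* a))
           refl (ι i) x (laguerre i 0) ⟩
    ι (suc i) * (x * laguerre i 0)          ≈⟨ *-congˡ (*-congˡ (laguerre-zero i)) ⟩
    ι (suc i) * (x * (i !) × (x ^ i))       ≈⟨ *-congˡ (M.×-comm-* (i !) x (x ^ i)) ⟩
    ι (suc i) * (i !) × (x * x ^ i)         ≈⟨ M.×-assoc-* (suc i) 1# _ ⟩
    suc i × (1# * (i !) × (x * x ^ i))      ≈⟨ M.×-congʳ (suc i) (*-identityˡ _) ⟩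
    suc i × ((i !) × (x * x ^ i))           ≈⟨ M.×-assocˡ (x * x ^ i) (suc i) (i !) ⟩
    (suc i !) × (x ^ suc i)                 ∎

  -- After expansion, `i` occurs in the coefficients only through `(m + x) * (ι i * l₀)`.
  -- `laguerre-contiguous` trades this for coefficients in `k` alone, which is the origin of the
  -- factor `x + m` in `γ`.
  laguerre-threeTerm : ∀ i k →
    (1# + m * ι i) * laguerre i k + laguerre (suc i) k ≈
    prev (laguerre i) k + β k * laguerre i k + γ k * laguerre i (suc k)
  laguerre-threeTerm i k = begin
    (1# + m * ι i) * l₀ + (p + (ι i + (1# + ι k)) * x * l₀)
      ≈⟨ solve 6 (λ m x i k a p → (con 1 :+ m :* i) :* a :+ (p :+ (i :+ (con 1 :+ k)) :* x :* a) :=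
           p :+ (con 1 :+ (con 1 :+ k) :* x) :* a :+ (m :+ x) :* (i :* a)) refl m x (ι i) (ι k) l₀ p ⟩
    p + (1# + (1# + ι k) * x) * l₀ + (m + x) * (ι i * l₀)
      ≈⟨ +-congˡ (*-congˡ (laguerre-contiguous i k)) ⟩
    p + (1# + (1# + ι k) * x) * l₀ + (m + x) * (ι k * l₀ + (1# + ι k) * (1# + ι k) * x * l₁)
      ≈⟨ solve 6 (λ m x k a b p →
           p :+ (con 1 :+ (con 1 :+ k) :* x) :* a :+
             (m :+ x) :* (k :* a :+ (con 1 :+ k) :* (con 1 :+ k) :* x :* b) :=
           p :+ (con 1 :+ m :* k :+ (k :+ (con 1 :+ k)) :* x) :* a :+
             (con 1 :+ k) :* (con 1 :+ k) :* (x :* (x :+ m)) :* b) refl m x (ι k) l₀ l₁ p ⟩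
    p + β k * l₀ + γ k * l₁
      ∎
    where
    p = prev (laguerre i) k
    l₀ = laguerre i k
    l₁ = laguerre i (suc k)

  moment : ℕ → ℕ → Carrier
  moment n k = ∑ (suc n) λ i → whitney n i * laguerre i k

  moment-zero : ∀ k → moment 0 k ≈ laguerre 0 k
  moment-zero k = trans (+-identityʳ _) (*-identityˡ _)

  moment-prev : ∀ n k → ∑ (suc n) (λ i → whitney n i * prev (laguerre i) k) ≈ prev (moment n) k
  moment-prev n zero    = trans (∑-cong (suc n) (λ i → *-comm (whitney n i) 0#))
    (trans (∑-*ˡ (suc n) 0# (whitney n)) (zeroˡ _))
  moment-prev n (suc k) = refl

  -- Summation by parts: the recurrence of `whitney` in `n` is transposed onto `f`.
  ∑-whitney-suc : ∀ n (f : ℕ → Carrier) →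
    ∑ (suc (suc n)) (λ i → whitney (suc n) i * f i) ≈
    ∑ (suc n) (λ i → whitney n i * ((1# + m * ι i) * f i + f (suc i)))
  ∑-whitney-suc n f = begin
    ∑ (suc (suc n)) (λ i → whitney (suc n) i * f i)
      ≈⟨ ∑-cong (suc (suc n)) (λ i → distribʳ (f i) ((1# + m * ι i) * whitney n i) (prev (whitney n) i)) ⟩
    ∑ (suc (suc n)) (λ i → g i + prev (whitney n) i * f i)
      ≈⟨ ∑-+ (suc (suc n)) g (λ i → prev (whitney n) i * f i) ⟩
    ∑ (suc (suc n)) g + (0# * f 0 + ∑ (suc n) (λ i → whitney n i * f (suc i)))
      ≈⟨ +-cong (∑-last (suc n) g) (trans (+-congʳ (zeroˡ (f 0))) (+-identityˡ _)) ⟩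
    (∑ (suc n) g + g (suc n)) + ∑ (suc n) (λ i → whitney n i * f (suc i))
      -- The top term of the longer sum contains `whitney n (suc n)`, which is 0, so both sums get
      -- the range of row `n`.
      ≈⟨ +-congʳ (trans (+-congˡ last≈0) (+-identityʳ _)) ⟩
    ∑ (suc n) g + ∑ (suc n) (λ i → whitney n i * f (suc i))
      ≈⟨ ∑-+ (suc n) g (λ i → whitney n i * f (suc i)) ⟨
    ∑ (suc n) (λ i → g i + whitney n i * f (suc i))
      ≈⟨ ∑-cong (suc n) (λ i → solve 4 (λ a w f f′ → a :* w :* f :+ w :* f′ := w :* (a :* f :+ f′)) refl
           (1# + m * ι i) (whitney n i) (f i) (f (suc i))) ⟩
    ∑ (suc n) (λ i → whitney n i * ((1# + m * ι i) * f i + f (suc i)))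
      ∎
    where
    g : ℕ → Carrier
    g i = (1# + m * ι i) * whitney n i * f i
    last≈0 : g (suc n) ≈ 0#
    last≈0 = trans (*-congʳ (trans (*-congˡ (whitney≈0 n (suc n) (ℕ.n<1+n n))) (zeroʳ _))) (zeroˡ _)

  -- `∑-whitney-suc` moves the step in `n` onto `laguerre`; there `laguerre-threeTerm` has
  -- coefficients independent of `i`, which come out of the sum.
  moment-threeTerm : ∀ n k →
    moment (suc n) k ≈ prev (moment n) k + β k * moment n k + γ k * moment n (suc k)
  moment-threeTerm n k = begin
    moment (suc n) k
      ≈⟨ ∑-whitney-suc n (λ i → laguerre i k) ⟩
    ∑ (suc n) (λ i → w i * ((1# + m * ι i) * laguerre i k + laguerre (suc i) k))
      ≈⟨ ∑-cong (suc n) (λ i → trans (*-congˡ (laguerre-threeTerm i k))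
           (solve 6 (λ w b g p a a′ → w :* (p :+ b :* a :+ g :* a′) :=
             w :* p :+ b :* (w :* a) :+ g :* (w :* a′)) refl
             (w i) (β k) (γ k) (prev (laguerre i) k) (laguerre i k) (laguerre i (suc k)))) ⟩
    ∑ (suc n) (λ i → w i * prev (laguerre i) k + β k * (w i * laguerre i k) + γ k * (w i * laguerre i (suc k)))
      ≈⟨ ∑-+ (suc n) (λ i → w i * prev (laguerre i) k + β k * (w i * laguerre i k))
           (λ i → γ k * (w i * laguerre i (suc k))) ⟩
    ∑ (suc n) (λ i → w i * prev (laguerre i) k + β k * (w i * laguerre i k))
      + ∑ (suc n) (λ i → γ k * (w i * laguerre i (suc k)))
      ≈⟨ +-cong (∑-+ (suc n) (λ i → w i * prev (laguerre i) k) (λ i → β k * (w i * laguerre i k)))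
           (∑-*ˡ (suc n) (γ k) (λ i → w i * laguerre i (suc k))) ⟩
    ∑ (suc n) (λ i → w i * prev (laguerre i) k) + ∑ (suc n) (λ i → β k * (w i * laguerre i k))
      + γ k * moment n (suc k)
      ≈⟨ +-congʳ (+-cong (moment-prev n k) (∑-*ˡ (suc n) (β k) (λ i → w i * laguerre i k))) ⟩
    prev (moment n) k + β k * moment n k + γ k * moment n (suc k)
      ∎
    where
    w = whitney n

  moment-tannyDowling : ∀ n → moment n 0 ≈ tannyDowlingSum n
  moment-tannyDowling n = ∑-cong (suc n) λ k →
    trans (*-congˡ (laguerre-zero k)) (M.×-comm-* (k !) (whitney n k) (x ^ k))

-- The action of polynomials on sequences.

module ThreeTerm {c ℓ} (K : CommutativeRing c ℓ) (isField : IsField K) where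

  open CommutativeRing K
  open IsField isField
  open Sequences K using (prev)
  open Polynomials K using (Poly; X; 1ₚ; _·_; coeff; coeffs; coeff-≈; coeff-+; coeff-·; IsMonicOfDegree; tail≈0)
    renaming (_+_ to _+ₚ_; _*_ to _*ₚ_; -_ to -ₚ_; _≈_ to _≈ₚ_; ≈-sym to ≈ₚ-sym; *-comm to *ₚ-comm)
  open RawSemiringOps (Semiring.rawSemiring (CommutativeRing.semiring (Polynomials.ring K))) using (_^_)
  open OrthogonalPolynomials K using (IsOrthogonalFamily)
    renaming (IsOrthogonalMomentSequence to IsMomentSequence)
  open SemiringSolver commutativeSemiring using (solve; con; _:*_; _:+_; _:=_)
  open SetoidReasoning setoid
  private
    module RP = RingProperties ring

  *-≉0 : ∀ {x y} → x ≉ 0# → y ≉ 0# → x * y ≉ 0#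
  *-≉0 {x} {y} x≉0 y≉0 xy≈0 with x⁻¹ , xx⁻¹≈1 ← inverse x x≉0 = y≉0 (begin
    y                ≈⟨ *-identityˡ y ⟨
    1# * y           ≈⟨ *-congʳ xx⁻¹≈1 ⟨
    x * x⁻¹ * y      ≈⟨ solve 3 (λ x x⁻¹ y → x :* x⁻¹ :* y := x⁻¹ :* (x :* y)) refl x x⁻¹ y ⟩
    x⁻¹ * (x * y)    ≈⟨ *-congˡ xy≈0 ⟩
    x⁻¹ * 0#         ≈⟨ zeroʳ x⁻¹ ⟩
    0#               ∎)

  infixr 7 _▷_

  -- The action of K[z] on sequences in which z acts as the shift: if μ is the
  -- moment sequence of 𝓛, then (p ▷ μ) n = 𝓛 (zⁿ p).
  _▷_ : Poly → (ℕ → Carrier) → ℕ → Carrier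
  ([]      ▷ s) n = 0#
  ((a ∷ p) ▷ s) n = a * s n + (p ▷ s) (suc n)

  ▷-congʳ : ∀ p {s t} → (∀ n → s n ≈ t n) → ∀ n → (p ▷ s) n ≈ (p ▷ t) n
  ▷-congʳ []      s≈t n = refl
  ▷-congʳ (a ∷ p) s≈t n = +-cong (*-congˡ (s≈t n)) (▷-congʳ p s≈t (suc n))

  ▷-zeroˡ : ∀ p → p ≈ₚ [] → ∀ s n → (p ▷ s) n ≈ 0#
  ▷-zeroˡ []      p≈0 s n = refl
  ▷-zeroˡ (a ∷ p) p≈0 s n = begin
    a * s n + (p ▷ s) (suc n)
      ≈⟨ +-cong (*-congʳ (coeff-≈ p≈0 0)) (▷-zeroˡ p (tail≈0 p≈0) s (suc n)) ⟩
    0# * s n + 0#              ≈⟨ trans (+-identityʳ _) (zeroˡ _) ⟩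
    0#                         ∎

  -- Equal polynomials may differ by trailing zeros; the surplus entries act as zero. This makes the
  -- functional `𝓛` well defined.
  ▷-congˡ : ∀ {p q} → p ≈ₚ q → ∀ s n → (p ▷ s) n ≈ (q ▷ s) n
  ▷-congˡ {[]}    {q}     p≈q s n = sym (▷-zeroˡ q (≈ₚ-sym p≈q) s n)
  ▷-congˡ {a ∷ p} {[]}    p≈q s n = ▷-zeroˡ (a ∷ p) p≈q s n
  ▷-congˡ {a ∷ p} {b ∷ q} p≈q s n =
    +-cong (*-congʳ (coeff-≈ p≈q 0)) (▷-congˡ {p} {q} (coeffs (coeff-≈ p≈q ∘ suc)) s (suc n))

  ▷-+ : ∀ p q s n → ((p +ₚ q) ▷ s) n ≈ (p ▷ s) n + (q ▷ s) n
  ▷-+ []      q       s n = sym (+-identityˡ _)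
  ▷-+ (a ∷ p) []      s n = sym (+-identityʳ _)
  ▷-+ (a ∷ p) (b ∷ q) s n = trans (+-congˡ (▷-+ p q s (suc n)))
    (solve 5 (λ a b s p q → (a :+ b) :* s :+ (p :+ q) := (a :* s :+ p) :+ (b :* s :+ q)) refl
      a b (s n) ((p ▷ s) (suc n)) ((q ▷ s) (suc n)))

  ▷-· : ∀ a p s n → ((a · p) ▷ s) n ≈ a * (p ▷ s) n
  ▷-· a []      s n = sym (zeroʳ a)
  ▷-· a (b ∷ p) s n = trans (+-congˡ (▷-· a p s (suc n)))
    (solve 4 (λ a b s p → a :* b :* s :+ a :* p := a :* (b :* s :+ p)) refl a b (s n) ((p ▷ s) (suc n)))

  ▷-neg : ∀ p s n → ((-ₚ p) ▷ s) n ≈ - (p ▷ s) n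
  ▷-neg []      s n = sym RP.-0#≈0#
  ▷-neg (a ∷ p) s n = begin
    - a * s n + ((-ₚ p) ▷ s) (suc n)    ≈⟨ +-cong (sym (RP.-‿distribˡ-* a (s n))) (▷-neg p s (suc n)) ⟩
    - (a * s n) + - (p ▷ s) (suc n)     ≈⟨ RP.-‿+-comm _ _ ⟩
    - (a * s n + (p ▷ s) (suc n))       ∎

  ▷-0∷ : ∀ p s n → ((0# ∷ p) ▷ s) n ≈ (p ▷ s) (suc n)
  ▷-0∷ p s n = trans (+-congʳ (zeroˡ (s n))) (+-identityˡ _)

  -- Multiplicativity lets `𝓛 (P i *ₚ P j)` be computed by letting `P i` act on the sequence
  -- `𝓛 (zⁿ P j)`.
  ▷-* : ∀ p q s n → ((p *ₚ q) ▷ s) n ≈ (p ▷ q ▷ s) n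
  ▷-* []      q s n = refl
  ▷-* (a ∷ p) q s n = trans (▷-+ (a · q) (0# ∷ p *ₚ q) s n)
    (+-cong (▷-· a q s n) (trans (▷-0∷ (p *ₚ q) s n) (▷-* p q s (suc n))))

  ▷-1 : ∀ s n → (1ₚ ▷ s) n ≈ s n
  ▷-1 s n = trans (+-identityʳ _) (*-identityˡ _)

  ▷-X^ : ∀ k s n → ((X ^ k) ▷ s) n ≈ s (n ℕ.+ k)
  ▷-X^ zero    s n = trans (▷-1 s n) (reflexive (≡.cong s (≡.sym (ℕ.+-identityʳ n))))
  ▷-X^ (suc k) s n = begin
    ((X *ₚ X ^ k) ▷ s) n          ≈⟨ ▷-* X (X ^ k) s n ⟩
    (X ▷ X ^ k ▷ s) n             ≈⟨ trans (▷-0∷ 1ₚ (X ^ k ▷ s) n) (▷-1 (X ^ k ▷ s) (suc n)) ⟩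
    (X ^ k ▷ s) (suc n)           ≈⟨ ▷-X^ k s (suc n) ⟩
    s (suc n ℕ.+ k)               ≈⟨ reflexive (≡.cong s (≡.sym (ℕ.+-suc n k))) ⟩
    s (n ℕ.+ suc k)               ∎

  ▷-zeroʳ : ∀ p s n → (∀ l → coeff p l * s (l ℕ.+ n) ≈ 0#) → (p ▷ s) n ≈ 0#
  ▷-zeroʳ []      s n ps≈0 = refl
  ▷-zeroʳ (a ∷ p) s n ps≈0 = trans (+-cong (ps≈0 0) (▷-zeroʳ p s (suc n) λ l →
    trans (*-congˡ (reflexive (≡.cong s (ℕ.+-suc l n)))) (ps≈0 (suc l)))) (+-identityˡ 0#)

  -- Meant for `p` of degree `k` and, at `n = 0`, a sequence vanishing below `k`: the coefficients
  -- kill the terms above `k`, the sequence those below.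
  ▷-single : ∀ p s n k → (∀ l → l ≢ k → coeff p l * s (l ℕ.+ n) ≈ 0#) →
    (p ▷ s) n ≈ coeff p k * s (k ℕ.+ n)
  ▷-single []      s n k       ps≈0 = sym (zeroˡ _)
  ▷-single (a ∷ p) s n zero    ps≈0 = trans (+-congˡ (▷-zeroʳ p s (suc n) λ l →
    trans (*-congˡ (reflexive (≡.cong s (ℕ.+-suc l n)))) (ps≈0 (suc l) λ ()))) (+-identityʳ _)
  ▷-single (a ∷ p) s n (suc k) ps≈0 = begin
    a * s n + (p ▷ s) (suc n)
      ≈⟨ +-cong (ps≈0 0 λ ()) (▷-single p s (suc n) k λ l l≢k →
           trans (*-congˡ (reflexive (≡.cong s (ℕ.+-suc l n)))) (ps≈0 (suc l) (l≢k ∘ ℕ.suc-injective))) ⟩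
    0# + coeff p k * s (k ℕ.+ suc n)
      ≈⟨ trans (+-identityˡ _) (*-congˡ (reflexive (≡.cong s (ℕ.+-suc k n)))) ⟩
    coeff p k * s (suc k ℕ.+ n)
      ∎

  -- Orthogonal polynomials from a three-term recurrence.

  module _
    (β γ : ℕ → Carrier) (γ≉0 : ∀ k → γ k ≉ 0#)
    (a : ℕ → ℕ → Carrier)
    (a-zero-zero : a 0 0 ≈ 1#)
    (a-zero-suc : ∀ k → a 0 (suc k) ≈ 0#)
    (a-suc : ∀ n k → a (suc n) k ≈ prev (a n) k + β k * a n k + γ k * a n (suc k))
    where

    a≈0 : ∀ n k → n ℕ.< k → a n k ≈ 0#
    a≈0 zero    (suc k) _         = a-zero-suc k
    a≈0 (suc n) (suc k) n+1<k+1 = begin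
      a (suc n) (suc k)
        ≈⟨ a-suc n (suc k) ⟩
      a n k + β (suc k) * a n (suc k) + γ (suc k) * a n (suc (suc k))
        ≈⟨ +-cong (+-cong (a≈0 n k n<k) (*-congˡ (a≈0 n (suc k) (ℕ.m<n⇒m<1+n n<k))))
             (*-congˡ (a≈0 n (suc (suc k)) (ℕ.m<n⇒m<1+n (ℕ.m<n⇒m<1+n n<k)))) ⟩
      0# + β (suc k) * 0# + γ (suc k) * 0#
        ≈⟨ solve 2 (λ b g → con 0 :+ b :* con 0 :+ g :* con 0 := con 0) refl (β (suc k)) (γ (suc k)) ⟩
      0# ∎
      where n<k = ℕ.s<s⁻¹ n+1<k+1

    a≈1 : ∀ n → a n n ≈ 1#
    a≈1 zero    = a-zero-zero
    a≈1 (suc n) = begin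
      a (suc n) (suc n)
        ≈⟨ a-suc n (suc n) ⟩
      a n n + β (suc n) * a n (suc n) + γ (suc n) * a n (suc (suc n))
        ≈⟨ +-cong (+-cong (a≈1 n) (*-congˡ (a≈0 n (suc n) (ℕ.n<1+n n))))
             (*-congˡ (a≈0 n (suc (suc n)) (ℕ.m<n⇒m<1+n (ℕ.n<1+n n)))) ⟩
      1# + β (suc n) * 0# + γ (suc n) * 0#
        ≈⟨ solve 2 (λ b g → con 1 :+ b :* con 0 :+ g :* con 0 := con 1) refl (β (suc n)) (γ (suc n)) ⟩
      1# ∎

    -- Here `0# ∷ p` is `z p`. Degree 1 has its own clause because only one predecessor exists.
    P : ℕ → Poly
    P zero          = 1ₚ
    P (suc zero)    = (0# ∷ 1ₚ) +ₚ (- β 0) · 1ₚ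
    P (suc (suc k)) = ((0# ∷ P (suc k)) +ₚ (- β (suc k)) · P (suc k)) +ₚ (- γ k) · P k

    -- The squared norms `γ_0 ⋯ γ_{k−1}` of the `P k`, as `𝓛-square` confirms.
    h : ℕ → Carrier
    h zero    = 1#
    h (suc k) = γ k * h k

    h≉0 : ∀ k → h k ≉ 0#
    h≉0 zero    = 1≉0
    h≉0 (suc k) = *-≉0 (γ≉0 k) (h≉0 k)

    μ : ℕ → Carrier
    μ n = a n 0

    P-monic : ∀ n → IsMonicOfDegree n (P n)
    P-monic n = lead n , vanish n
      where
      -- Adding a multiple of a polynomial without terms from degree `i` on preserves the
      -- coefficient at `i`. This is applied to each of the two lower terms of the recurrence.
      cancelling : ∀ q p b k i → (∀ j → i ℕ.≤ j → coeff p j ≈ 0#) → k ≈ coeff q i →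
        coeff (q +ₚ b · p) i ≈ k
      cancelling q p b k i p≈0 k≈q = begin
        coeff (q +ₚ b · p) i          ≈⟨ coeff-+ q (b · p) i ⟩
        coeff q i + coeff (b · p) i   ≈⟨ +-cong (sym k≈q) (trans (coeff-· b p i) (*-congˡ (p≈0 i ℕ.≤-refl))) ⟩
        k + b * 0#                    ≈⟨ trans (+-congˡ (zeroʳ b)) (+-identityʳ k) ⟩
        k                             ∎
      zP-βP : ℕ → Poly
      zP-βP n = (0# ∷ P (suc n)) +ₚ (- β (suc n)) · P (suc n)
      vanish : ∀ n i → n ℕ.< i → coeff (P n) i ≈ 0#
      vanish zero          (suc i) _         = refl
      vanish (suc zero)    (suc zero) (ℕ.s≤s ())
      vanish (suc zero)    (suc (suc i)) _   = refl
      vanish (suc (suc n)) (suc i) (ℕ.s≤s n+1<i) =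
        cancelling (zP-βP n) (P n) (- γ n) 0# (suc i)
          (λ j i<j → vanish n j (ℕ.<-trans (ℕ.n<1+n n) (ℕ.<-trans n+1<i i<j)))
          (sym (cancelling (0# ∷ P (suc n)) (P (suc n)) (- β (suc n)) 0# (suc i)
            (λ j i<j → vanish (suc n) j (ℕ.<-trans n+1<i i<j))
            (sym (vanish (suc n) i n+1<i))))
      lead : ∀ n → coeff (P n) n ≈ 1#
      lead zero          = refl
      lead (suc zero)    = refl
      lead (suc (suc n)) =
        cancelling (zP-βP n) (P n) (- γ n) 1# (suc (suc n))
          (λ j n+1<j → vanish n j (ℕ.<-trans (ℕ.n<1+n n) n+1<j))
          (sym (cancelling (0# ∷ P (suc n)) (P (suc n)) (- β (suc n)) 1# (suc (suc n))
            (vanish (suc n))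
            (sym (lead (suc n)))))

    -- Multiplication by `z` replaces `n` by `n + 1`, so `a-suc` applies; the subtracted `β` and `γ`
    -- terms of `P` cancel all of it but the term in `a n (k + 1)`.
    P▷μ : ∀ k n → (P k ▷ μ) n ≈ h k * a n k
    P▷μ zero n = trans (▷-1 μ n) (sym (*-identityˡ _))
    P▷μ (suc zero) n = begin
      (P 1 ▷ μ) n
        ≈⟨ ▷-+ (0# ∷ 1ₚ) ((- β 0) · 1ₚ) μ n ⟩
      ((0# ∷ 1ₚ) ▷ μ) n + ((- β 0) · 1ₚ ▷ μ) n
        ≈⟨ +-cong (trans (▷-0∷ 1ₚ μ n) (trans (▷-1 μ (suc n)) (a-suc n 0)))
             (trans (▷-· (- β 0) 1ₚ μ n) (*-congˡ (▷-1 μ n))) ⟩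
      (0# + β 0 * a n 0 + γ 0 * a n 1) + - β 0 * a n 0
        -- The solver is for semirings: the negative is a separate variable, and the cancelling pair
        -- is isolated as a sum.
        ≈⟨ solve 5 (λ b b⁻ g x y → (con 0 :+ b :* x :+ g :* y) :+ b⁻ :* x :=
             g :* con 1 :* y :+ (b :+ b⁻) :* x) refl (β 0) (- β 0) (γ 0) (a n 0) (a n 1) ⟩
      γ 0 * 1# * a n 1 + (β 0 + - β 0) * a n 0
        ≈⟨ +-congˡ (trans (*-congʳ (-‿inverseʳ (β 0))) (zeroˡ _)) ⟩
      γ 0 * 1# * a n 1 + 0#
        ≈⟨ +-identityʳ _ ⟩
      γ 0 * 1# * a n 1 ∎
    P▷μ (suc (suc k)) n = begin
      (P (suc (suc k)) ▷ μ) n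
        ≈⟨ trans (▷-+ ((0# ∷ P (suc k)) +ₚ b⁻ · P (suc k)) (g⁻ · P k) μ n)
             (+-congʳ (▷-+ (0# ∷ P (suc k)) (b⁻ · P (suc k)) μ n)) ⟩
      ((0# ∷ P (suc k)) ▷ μ) n + (b⁻ · P (suc k) ▷ μ) n + (g⁻ · P k ▷ μ) n
        ≈⟨ +-cong (+-cong (trans (▷-0∷ (P (suc k)) μ n) (trans (P▷μ (suc k) (suc n)) (*-congˡ (a-suc n (suc k)))))
             (trans (▷-· b⁻ (P (suc k)) μ n) (*-congˡ (P▷μ (suc k) n))))
             (trans (▷-· g⁻ (P k) μ n) (*-congˡ (P▷μ k n))) ⟩
      γ k * h k * (a n k + b * a n (suc k) + γ (suc k) * a n (suc (suc k)))
        + b⁻ * (γ k * h k * a n (suc k)) + g⁻ * (h k * a n k)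
        ≈⟨ solve 9 (λ b b⁻ g g⁻ g′ h x y z →
             g :* h :* (x :+ b :* y :+ g′ :* z) :+ b⁻ :* (g :* h :* y) :+ g⁻ :* (h :* x) :=
             g′ :* (g :* h) :* z :+ ((b :+ b⁻) :* (g :* h :* y) :+ (g :+ g⁻) :* (h :* x))) refl
             b b⁻ (γ k) g⁻ (γ (suc k)) (h k) (a n k) (a n (suc k)) (a n (suc (suc k))) ⟩
      h (suc (suc k)) * a n (suc (suc k)) + ((b + b⁻) * (γ k * h k * a n (suc k)) + (γ k + g⁻) * (h k * a n k))
        ≈⟨ +-congˡ (+-cong (trans (*-congʳ (-‿inverseʳ b)) (zeroˡ _)) (trans (*-congʳ (-‿inverseʳ (γ k))) (zeroˡ _))) ⟩
      h (suc (suc k)) * a n (suc (suc k)) + (0# + 0#)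
        ≈⟨ trans (+-congˡ (+-identityʳ 0#)) (+-identityʳ _) ⟩
      h (suc (suc k)) * a n (suc (suc k)) ∎
      where
      b = β (suc k)
      b⁻ = - b
      g⁻ = - γ k

    𝓛 : Poly → Carrier
    𝓛 p = (p ▷ μ) 0

    -- In the expansion of `P i`, terms with `l > i` vanish by degree, and those with `l < i ≤ j`
    -- because `a` is triangular.
    𝓛-* : ∀ i j → i ℕ.≤ j → 𝓛 (P i *ₚ P j) ≈ coeff (P i) i * (h j * a i j)
    𝓛-* i j i≤j = begin
      ((P i *ₚ P j) ▷ μ) 0                      ≈⟨ ▷-* (P i) (P j) μ 0 ⟩
      (P i ▷ P j ▷ μ) 0                         ≈⟨ ▷-congʳ (P i) (P▷μ j) 0 ⟩
      (P i ▷ λ n → h j * a n j) 0               ≈⟨ ▷-single (P i) (λ n → h j * a n j) 0 i off-diagonal ⟩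
      coeff (P i) i * (h j * a (i ℕ.+ 0) j)     ≈⟨ *-congˡ (*-congˡ (reflexive (≡.cong (λ l → a l j) (ℕ.+-identityʳ i)))) ⟩
      coeff (P i) i * (h j * a i j)             ∎
      where
      off-diagonal : ∀ l → l ≢ i → coeff (P i) l * (h j * a (l ℕ.+ 0) j) ≈ 0#
      off-diagonal l l≢i with ℕ.<-cmp l i
      ... | tri≈ _ l≡i _ = ⊥-elim (l≢i l≡i)
      ... | tri> _ _ l>i = trans (*-congʳ (proj₂ (P-monic i) l l>i)) (zeroˡ _)
      ... | tri< l<i _ _ rewrite ℕ.+-identityʳ l = trans
              (*-congˡ (trans (*-congˡ (a≈0 l j (ℕ.<-≤-trans l<i i≤j))) (zeroʳ _))) (zeroʳ _)

    𝓛-orthogonal : ∀ i j → i ℕ.< j → 𝓛 (P i *ₚ P j) ≈ 0#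
    𝓛-orthogonal i j i<j = trans (𝓛-* i j (ℕ.<⇒≤ i<j))
      (trans (*-congˡ (trans (*-congˡ (a≈0 i j i<j)) (zeroʳ _))) (zeroʳ _))

    𝓛-square : ∀ n → 𝓛 (P n *ₚ P n) ≈ h n
    𝓛-square n = trans (𝓛-* n n ℕ.≤-refl) (trans
      (*-cong (proj₁ (P-monic n)) (trans (*-congˡ (a≈1 n)) (*-identityʳ _))) (*-identityˡ _))

    isOrthogonalFamily : IsOrthogonalFamily P 𝓛
    isOrthogonalFamily = record
      { monic = P-monic
      ; linear = record
        { +ᴹ-isGroupHomomorphism = record
          { isMonoidHomomorphism = record
            { isMagmaHomomorphism = record
              { isRelHomomorphism = record { cong = λ p≈q → ▷-congˡ p≈q μ 0 }
              ; homo = λ p q → ▷-+ p q μ 0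
              }
            ; ε-homo = refl
            }
          ; ⁻¹-homo = λ p → ▷-neg p μ 0
          }
        ; *ₗ-homo = λ b p → ▷-· b p μ 0
        }
      ; normalised = trans (▷-1 μ 0) a-zero-zero
      ; orthogonal = orthogonal
      ; nondegenerate = λ n 𝓛≈0 → h≉0 n (trans (sym (𝓛-square n)) 𝓛≈0)
      }
      where
      orthogonal : ∀ i j → i ≢ j → 𝓛 (P i *ₚ P j) ≈ 0#
      orthogonal i j i≢j with ℕ.<-cmp i j
      ... | tri< i<j _ _ = 𝓛-orthogonal i j i<j
      ... | tri≈ _ i≡j _ = ⊥-elim (i≢j i≡j)
      ... | tri> _ _ i>j = trans (▷-congˡ (*ₚ-comm (P i) (P j)) μ 0) (𝓛-orthogonal j i i>j)

    isMomentSequence : ∀ {ν} → (∀ n → a n 0 ≈ ν n) → IsMomentSequence ν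
    isMomentSequence a≈ν = P , 𝓛 , isOrthogonalFamily , λ n → trans (▷-X^ n μ 0) (a≈ν n)

-- Tanny-Dowling polynomials through Whitney numbers in the polynomial ring.

module PolynomialTannyDowling {c ℓ} (R : CommutativeRing c ℓ) (m : CommutativeRing.Carrier R) where

  private
    module R = CommutativeRing R
    module WR = Whitney R m
    module SR = Sequences R
    module Rₓ = Polynomials R
  open TannyDowling R using (whitney₂) renaming (tannyDowling to tannyDowlingₓ)
  open Rₓ using (const; X; _·_; ∷-cong; 0∷0≈0)
  open CommutativeRing Rₓ.ring
  open Sequences Rₓ.ring
  open Whitney Rₓ.ring (const m) using (whitney)
  open Moments Rₓ.ring (const m) X using (tannyDowlingSum)
  private module M = Mult semiring
  open RawSemiringOps (Semiring.rawSemiring semiring) using (_^_)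
  open SetoidReasoning setoid

  const-* : ∀ a b → const (a R.* b) ≈ const a * const b
  const-* a b = ∷-cong (R.sym (R.+-identityʳ _)) refl

  const-*-· : ∀ a p → const a * p ≈ a · p
  const-*-· a p = trans (+-congˡ {a · p} (0∷0≈0 R.refl refl)) (+-identityʳ (a · p))

  const-0 : const R.0# ≈ 0#
  const-0 = 0∷0≈0 R.refl refl

  const-ι : ∀ n → const (SR.ι n) ≈ ι n
  const-ι zero    = const-0
  const-ι (suc n) = +-congˡ {1#} (const-ι n)

  -- The recurrence consists of ring operations, which `const` preserves.
  const-whitney : ∀ n k → const (WR.whitney n k) ≈ whitney n k
  const-whitney zero    zero    = refl
  const-whitney zero    (suc k) = const-0
  const-whitney (suc n) k = begin
    const ((R.1# R.+ m R.* SR.ι k) R.* WR.whitney n k) + const (SR.prev (WR.whitney n) k)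
      ≈⟨ +-cong
           (trans (const-* (R.1# R.+ m R.* SR.ι k) (WR.whitney n k))
             (*-cong (+-congˡ {1#} (trans (const-* m (SR.ι k)) (*-congˡ {const m} (const-ι k))))
               (const-whitney n k)))
           (const-prev k) ⟩
    (1# + const m * ι k) * whitney n k + prev (whitney n) k
      ∎
    where
    const-prev : ∀ k → const (SR.prev (WR.whitney n) k) ≈ prev (whitney n) k
    const-prev zero    = const-0
    const-prev (suc k) = const-whitney n k

  tannyDowling≈tannyDowlingSum : ∀ n → tannyDowlingₓ m n ≈ tannyDowlingSum n
  tannyDowling≈tannyDowlingSum n = ∑-cong (suc n) λ k → M.×-congʳ (k !) (begin
    whitney₂ m n k · X ^ k           ≈⟨ Rₓ.·-cong (WR.whitney₂≈whitney n k) refl ⟩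
    WR.whitney n k · X ^ k             ≈⟨ const-*-· (WR.whitney n k) (X ^ k) ⟨
    const (WR.whitney n k) * X ^ k     ≈⟨ *-congʳ (const-whitney n k) ⟩
    whitney n k * X ^ k                ∎)

-- Passage to the field of fractions.

module Embedding {c ℓ} (D : CommutativeRing c ℓ) (isStableDomain : IsStableDomain D) where

  private
    module D = CommutativeRing D
    module SD = Sequences D
  open Fractions D isStableDomain using (embed; cross; cross-≈)
  open CommutativeRing (Fractions.ring D isStableDomain)
  open Sequences (Fractions.ring D isStableDomain) using (prev)

  embed-cong : ∀ {a b} → a D.≈ b → embed a ≈ embed b
  embed-cong a≈b = cross (D.*-congʳ a≈b)

  embed-+ : ∀ a b → embed (a D.+ b) ≈ embed a + embed b
  embed-+ a b = cross (D.*-cong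
    (D.sym (D.+-cong (D.*-identityʳ a) (D.*-identityʳ b))) (D.*-identityʳ D.1#))

  embed-* : ∀ a b → embed (a D.* b) ≈ embed a * embed b
  embed-* a b = cross (D.*-congˡ (D.*-identityʳ D.1#))

  embed-prev : ∀ f k → embed (SD.prev f k) ≈ prev (λ k → embed (f k)) k
  embed-prev f zero    = refl
  embed-prev f (suc k) = refl

  embed-≉0 : ∀ {a} → a D.≉ D.0# → embed a ≉ 0#
  embed-≉0 a≉0 a≈0 = a≉0 (D.trans (D.sym (D.*-identityʳ _))
    (D.trans (cross-≈ a≈0) (D.zeroˡ D.1#)))

-- Nonvanishing of `γ` and the conclusion over ℂ(x).

private
  module ℂᵣ = CommutativeRing ComplexNumbers.ring
  module ℂₓ = CommutativeRing ℂ[x].ring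
  module ℂS = Sequences ComplexNumbers.ring
  module ℂₓS = Sequences ℂ[x].ring
open Embedding ℂ[x].ring (ℂ[x].ring-isStableDomain ComplexNumbers.isStableDomain)

-- Characteristic zero: every entry of the rational sequence for the real part is at least 1, so the
-- sequence cannot come within 1 of zero.
ι-suc≉0 : ∀ n → ℂS.ι (suc n) ℂᵣ.≉ ℂᵣ.0#
ι-suc≉0 n n+1≈0 with N , p ← Reals.≈0⇒Null (ComplexNumbers._≈_.re-≈ n+1≈0) 1ℚ (ℚ.positive⁻¹ 1ℚ) =
  ℚ.<-irrefl ≡.refl (ℚ.≤-<-trans (1≤ n N)
    (≡.subst (ℚ._< 1ℚ) (ℚ.0≤p⇒∣p∣≡p (0≤ (suc n) N)) (p N ℕ.≤-refl)))
  where
  0≤ : ∀ n i → 0ℚ ℚ.≤ Reals.seq (ComplexNumbers.re (ℂS.ι n)) i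
  0≤ zero    i = ℚ.≤-refl
  0≤ (suc n) i = ℚ.+-mono-≤ (ℚ.nonNegative⁻¹ 1ℚ) (0≤ n i)
  1≤ : ∀ n i → 1ℚ ℚ.≤ Reals.seq (ComplexNumbers.re (ℂS.ι (suc n))) i
  1≤ n i = ℚ.+-mono-≤ (ℚ.≤-refl {1ℚ}) (0≤ n i)

proposition5 : (m : ℂ) → IsOrthogonalMomentSequence (λ n → ℂ⟨x⟩.embed (tannyDowling m n))
proposition5 m = ThreeTerm.isMomentSequence ℂ⟨x⟩.ring ℂ⟨x⟩.isField
  (λ k → ℂ⟨x⟩.embed (β k)) (λ k → ℂ⟨x⟩.embed (γ k)) (λ k → embed-≉0 (γ≉0 k))
  (λ n k → ℂ⟨x⟩.embed (moment n k))
  (embed-cong (moment-zero 0)) (λ k → embed-cong (moment-zero (suc k)))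
  embed-threeTerm
  (λ n → embed-cong (ℂₓ.trans (moment-tannyDowling n) (ℂₓ.sym (tannyDowling≈tannyDowlingSum n))))
  where
  open PolynomialTannyDowling ComplexNumbers.ring m using (tannyDowling≈tannyDowlingSum; const-ι)
  open Moments ℂ[x].ring (ℂ[x].const m) ℂ[x].X
  module K = CommutativeRing ℂ⟨x⟩.ring
  open Sequences ℂ⟨x⟩.ring using (prev)
  open SetoidReasoning K.setoid

  ι≉0 : ∀ k → ℂₓS.ι (suc k) ℂₓ.≉ ℂₓ.0#
  ι≉0 k k+1≈0 = ι-suc≉0 k (ℂ[x].coeff-≈ (ℂₓ.trans (const-ι (suc k)) k+1≈0) 0)

  -- ℂ[x] is a domain, `k + 1` is nonzero, and `X` and `X + m` have linear coefficient 1 for every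
  -- `m`, including 0.
  γ≉0 : ∀ k → γ k ℂₓ.≉ ℂₓ.0#
  γ≉0 k = ℂ⟨x⟩.*-≉0 {ℂₓS.ι (suc k) ℂₓ.* ℂₓS.ι (suc k)} {ℂ[x].X ℂₓ.* X+m}
    (ℂ⟨x⟩.*-≉0 {ℂₓS.ι (suc k)} {ℂₓS.ι (suc k)} (ι≉0 k) (ι≉0 k))
    (ℂ⟨x⟩.*-≉0 {ℂ[x].X} {X+m}
      (λ X≈0 → 1≉0 (ℂ[x].coeff-≈ X≈0 1))
      (λ X+m≈0 → 1≉0 (ℂ[x].coeff-≈ X+m≈0 1)))
    where
    open IsStableDomain ComplexNumbers.isStableDomain using (1≉0)
    X+m = ℂ[x].X ℂₓ.+ ℂ[x].const m

  embed-threeTerm : ∀ n k → ℂ⟨x⟩.embed (moment (suc n) k) K.≈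
    prev (λ k → ℂ⟨x⟩.embed (moment n k)) k K.+ ℂ⟨x⟩.embed (β k) K.* ℂ⟨x⟩.embed (moment n k)
      K.+ ℂ⟨x⟩.embed (γ k) K.* ℂ⟨x⟩.embed (moment n (suc k))
  embed-threeTerm n k = begin
    ℂ⟨x⟩.embed (moment (suc n) k)
      ≈⟨ embed-cong (moment-threeTerm n k) ⟩
    ℂ⟨x⟩.embed (ℂₓS.prev (moment n) k ℂₓ.+ β k ℂₓ.* moment n k ℂₓ.+ γ k ℂₓ.* moment n (suc k))
      ≈⟨ embed-+ (ℂₓS.prev (moment n) k ℂₓ.+ β k ℂₓ.* moment n k) (γ k ℂₓ.* moment n (suc k)) ⟩
    ℂ⟨x⟩.embed (ℂₓS.prev (moment n) k ℂₓ.+ β k ℂₓ.* moment n k) K.+ ℂ⟨x⟩.embed (γ k ℂₓ.* moment n (suc k))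
      ≈⟨ K.+-cong
           (K.trans (embed-+ (ℂₓS.prev (moment n) k) (β k ℂₓ.* moment n k))
             (K.+-cong (embed-prev (moment n) k) (embed-* (β k) (moment n k))))
           (embed-* (γ k) (moment n (suc k))) ⟩
    _ ∎
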